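{- Let $(F_n)_{n\ge 0}$ and $(L_n)_{n\ge 0}$ be the Fibonacci and Lucas sequences. Let $2\le b\le 10$ be an integer. Then the only tuples $(n,m,k,b,d)$ of non-negative integers $n,m,k$ satisfying \[ L_n = L_m\cdot b^d + F_k, \] where $d$ is the number of digits of $F_k$ in base $b$, are the following: \begin{itemize} \item $b=2$: $(0,1,0,2,1)$, $(2,1,1,2,1)$, $(2,1,2,2,1)$, $(3,0,0,2,1)$, $(4,1,4,2,2)$, $(4,2,1,2,1)$, $(4,2,2,2,1)$, $(5,0,4,2,2)$, $(6,3,3,2,2)$, $(7,1,7,2,4)$, $(7,2,5,2,3)$, $(8,5,4,2,2)$; \item $b=3$: $(2,1,0,3,1)$, $(3,1,1,3,1)$, $(3,1,2,3,1)$, $(4,0,1,3,1)$, $(4,0,2,3,1)$, $(5,2,3,3,1)$; \item $b=4$: $(3,1,0,4,1)$, $(4,1,4,4,1)$, $(5,0,4,4,1)$, $(6,3,3,4,1)$, $(7,1,7,4,2)$, $(7,4,1,4,1)$, $(7,4,2,4,1)$, $(8,5,4,4,1)$; \item $b=5$: $(4,1,3,5,1)$, $(5,0,1,5,1)$, $(5,0,2,5,1)$, $(6,2,4,5,1)$; \item $b=6$: $(4,1,1,6,1)$, $(4,1,2,6,1)$, $(5,1,5,6,1)$, $(6,2,0,6,1)$, $(7,3,5,6,1)$, $(8,4,5,6,1)$, $(13,0,11,6,3)$; \item $b=7$: $(4,1,0,7,1)$, $(7,3,1,7,1)$, $(7,3,2,7,1)$; \item $b=8$: $(5,1,4,8,1)$,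 $(6,0,3,8,1)$, $(7,2,5,8,1)$; \item $b=9$: $(5,1,3,9,1)$, $(6,0,0,9,1)$, $(7,2,3,9,1)$; \item $b=10$: $(5,1,1,10,1)$, $(5,1,2,10,1)$, $(6,1,6,10,1)$. \end{itemize} In particular, for $b=10$ the only Lucas numbers arising are $L_5=10\cdot L_1+F_1=10\cdot L_1+F_2=11$ and $L_6=10\cdot L_1+F_6=18$.
   Context: $F_0=0$, $F_1=1$, $F_{n+2}=F_{n+1}+F_n$; $L_0=2$, $L_1=1$, $L_{n+2}=L_{n+1}+L_n$. For a positive integer $N$, its number of digits in base $b$ is $\lfloor \log_b N\rfloor+1$; as reflected in the listed solutions, the number $F_0=0$ is regarded as having one digit ($d=1$). -}

module Defs where

open import Data.Nat using (ℕ; zero; suc; _+_; _*_; _∸_; _^_; _≤_; _<_)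
open import Data.Product using (_×_; _,_)
open import Data.List using (List; []; _∷_)
open import Relation.Binary.PropositionalEquality using (_≡_)

F : ℕ → ℕ
F zero = 0
F (suc zero) = 1
F (suc (suc n)) = F (suc n) + F n

L : ℕ → ℕ
L zero = 2
L (suc zero) = 1
L (suc (suc n)) = L (suc n) + L n

-- NumDigits b N d : d is the number of digits of N in base b.
-- For N ≥ 1 this is d = ⌊log_b N⌋ + 1, i.e. d ≥ 1 and b^(d-1) ≤ N < b^d.
-- By convention (as in the paper), N = 0 has exactly one digit.
data NumDigits (b : ℕ) : ℕ → ℕ → Set where
  zero-digits : NumDigits b 0 1
  pos-digits  : ∀ {N d} → 1 ≤ N → b ^ d ≤ N → N < b ^ suc d → NumDigits b N (suc d)

-- The tuple (n, m, k, b, d)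
Tuple : Set
Tuple = ℕ × ℕ × ℕ × ℕ × ℕ

solutions : List Tuple
solutions =
  (0 , 1 , 0 , 2 , 1) ∷ (2 , 1 , 1 , 2 , 1) ∷ (2 , 1 , 2 , 2 , 1) ∷ (3 , 0 , 0 , 2 , 1) ∷
  (4 , 1 , 4 , 2 , 2) ∷ (4 , 2 , 1 , 2 , 1) ∷ (4 , 2 , 2 , 2 , 1) ∷ (5 , 0 , 4 , 2 , 2) ∷
  (6 , 3 , 3 , 2 , 2) ∷ (7 , 1 , 7 , 2 , 4) ∷ (7 , 2 , 5 , 2 , 3) ∷ (8 , 5 , 4 , 2 , 2) ∷
  (2 , 1 , 0 , 3 , 1) ∷ (3 , 1 , 1 , 3 , 1) ∷ (3 , 1 , 2 , 3 , 1) ∷ (4 , 0 , 1 , 3 , 1) ∷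
  (4 , 0 , 2 , 3 , 1) ∷ (5 , 2 , 3 , 3 , 1) ∷
  (3 , 1 , 0 , 4 , 1) ∷ (4 , 1 , 4 , 4 , 1) ∷ (5 , 0 , 4 , 4 , 1) ∷ (6 , 3 , 3 , 4 , 1) ∷
  (7 , 1 , 7 , 4 , 2) ∷ (7 , 4 , 1 , 4 , 1) ∷ (7 , 4 , 2 , 4 , 1) ∷ (8 , 5 , 4 , 4 , 1) ∷
  (4 , 1 , 3 , 5 , 1) ∷ (5 , 0 , 1 , 5 , 1) ∷ (5 , 0 , 2 , 5 , 1) ∷ (6 , 2 , 4 , 5 , 1) ∷
  (4 , 1 , 1 , 6 , 1) ∷ (4 , 1 , 2 , 6 , 1) ∷ (5 , 1 , 5 , 6 , 1) ∷ (6 , 2 , 0 , 6 , 1) ∷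
  (7 , 3 , 5 , 6 , 1) ∷ (8 , 4 , 5 , 6 , 1) ∷ (13 , 0 , 11 , 6 , 3) ∷
  (4 , 1 , 0 , 7 , 1) ∷ (7 , 3 , 1 , 7 , 1) ∷ (7 , 3 , 2 , 7 , 1) ∷
  (5 , 1 , 4 , 8 , 1) ∷ (6 , 0 , 3 , 8 , 1) ∷ (7 , 2 , 5 , 8 , 1) ∷
  (5 , 1 , 3 , 9 , 1) ∷ (6 , 0 , 0 , 9 , 1) ∷ (7 , 2 , 3 , 9 , 1) ∷
  (5 , 1 , 1 , 10 , 1) ∷ (5 , 1 , 2 , 10 , 1) ∷ (6 , 1 , 6 , 10 , 1) ∷ []

{-# OPTIONS --safe #-}
module Submission where

-- Writing n + 2 = m + k + u, the digit condition F k < bᵈ ≤ 10 F k forces 0 ≤ u ≤ 8.  For k < 21 this leaves finitely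
-- many pairs of gap n - m and factor bᵈ, and for each of them L n and L m bᵈ + F k grow apart monotonically.
--
-- For k ≥ 21 write bᵈ = pᴰ with p ∈ {2, 3, 5, 6, 7, 10}; then D is so large that L n ≡ F k modulo a fixed power of every
-- prime factor of p.  Together with the congruences L n ≡ L m pᴰ + F k modulo well-chosen primes, all of which only depend
-- on residues of (m, k, D), this eliminates every residue class, so no linear forms in logarithms are needed, with one
-- exception: for p = 3, 7 and u = 2 the trivial solution k = D = 0, n = m survives locally, because p can divide L m to an
-- arbitrarily high power.  Near it D is even and 2h ∥ k for a power of two h = 2ʲ not dividing m; modulo L h one has
-- F k ≡ 0 and L (m + k) ≡ - L m, so L h divides pᴰ + 1, which is impossible for an even D as L h ≡ 3 (mod 4).

open import Defs
open import Data.Bool using (Bool; true; false; _∧_; _∨_; not; if_then_else_)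
open import Data.Bool.Properties using (T-≡)
open import Data.Empty using (⊥; ⊥-elim)
open import Data.List using (List; []; _∷_)
open import Data.List.Membership.DecPropositional using (_∈?_)
open import Data.List.Membership.Propositional using (_∈_)
open import Data.List.Relation.Unary.Any using (here; there)
open import Data.Nat using (ℕ; zero; suc; pred; _+_; _*_; _^_; _∸_; _/_; _%_; _≤_; _<_; z≤n; s≤s; _≡ᵇ_; _<ᵇ_; _≟_; _≤?_; _<?_; NonZero; >-nonZero)
open import Data.Nat.Coprimality using (Coprime; coprime-divisor)
open import Data.Nat.DivMod
open import Data.Nat.Divisibility
open import Data.Nat.Induction using (<-rec)
open import Data.Nat.Properties
open import Data.Nat.Tactic.RingSolver using (solve-∀)
open import Data.Product using (_×_; _,_; proj₁; proj₂; ∃; ∃₂)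
open import Data.Product.Properties using (≡-dec)
open import Data.Sum using (_⊎_; inj₁; inj₂)
open import Function.Base using (id)
open import Function.Bundles using (Equivalence; _⇔_; mk⇔)
open import Relation.Binary.Definitions using (DecidableEquality)
open import Relation.Binary.PropositionalEquality using (_≡_; refl; sym; trans; cong; cong₂; subst; subst₂; module ≡-Reasoning)
open import Relation.Nullary using (¬_; Dec; yes; no; does)
open import Relation.Nullary.Decidable using (map′; _×-dec_; dec-true)

-- Fibonacci-like sequences

FibonacciLike : (ℕ → ℕ) → Set
FibonacciLike X = ∀ n → X (suc (suc n)) ≡ X (suc n) + X n

F-like : FibonacciLike F
F-like _ = refl

L-like : FibonacciLike L
L-like _ = refl

-- Stated for an arbitrary sequence because `X = F` gives the doubling formulas and `X = L` splits
-- `L n` at `m`.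
addition : ∀ X → FibonacciLike X → ∀ a j → X (a + suc j) ≡ F (suc j) * X (suc a) + F j * X a
addition X X-like a zero = trans (cong X (+-comm a 1)) (one (X (suc a)))
  where
  one : ∀ x → x ≡ 1 * x + 0
  one = solve-∀
addition X X-like a (suc j) = begin
  X (a + suc (suc j))                                  ≡⟨ cong X (+-suc a (suc j)) ⟩
  X (suc a + suc j)                                    ≡⟨ addition X X-like (suc a) j ⟩
  F (suc j) * X (suc (suc a)) + F j * X (suc a)        ≡⟨ cong (λ x → F (suc j) * x + F j * X (suc a)) (X-like a) ⟩
  F (suc j) * (X (suc a) + X a) + F j * X (suc a)      ≡⟨ regroup (F (suc j)) (F j) (X (suc a)) (X a) ⟩
  F (suc (suc j)) * X (suc a) + F (suc j) * X a        ∎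
  where
  open ≡-Reasoning
  regroup : ∀ f′ f x′ x → f′ * (x′ + x) + f * x′ ≡ (f′ + f) * x′ + f′ * x
  regroup = solve-∀

L+F : ∀ n → L n + F n ≡ 2 * F (suc n)
L+F zero = refl
L+F (suc zero) = refl
L+F (suc (suc n)) = begin
  (L (suc n) + L n) + (F (suc n) + F n)     ≡⟨ swap (L (suc n)) (L n) (F (suc n)) (F n) ⟩
  (L (suc n) + F (suc n)) + (L n + F n)     ≡⟨ cong₂ _+_ (L+F (suc n)) (L+F n) ⟩
  2 * F (suc (suc n)) + 2 * F (suc n)       ≡⟨ sym (*-distribˡ-+ 2 (F (suc (suc n))) (F (suc n))) ⟩
  2 * F (suc (suc (suc n)))                 ∎
  where
  open ≡-Reasoning
  swap : ∀ a b c d → (a + b) + (c + d) ≡ (a + c) + (b + d)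
  swap = solve-∀

L-suc : ∀ n → L (suc n) ≡ F (suc n) + 2 * F n
L-suc n = +-cancelʳ-≡ (F (suc n)) (L (suc n)) (F (suc n) + 2 * F n) (begin
  L (suc n) + F (suc n)                  ≡⟨ L+F (suc n) ⟩
  2 * (F (suc n) + F n)                  ≡⟨ regroup (F (suc n)) (F n) ⟩
  (F (suc n) + 2 * F n) + F (suc n)      ∎)
  where
  open ≡-Reasoning
  regroup : ∀ a b → 2 * (a + b) ≡ (a + 2 * b) + a
  regroup = solve-∀

F-mono-+ : ∀ k d → F k ≤ F (d + k)
F-mono-+ k zero = ≤-refl
F-mono-+ k (suc d) = ≤-trans (F-mono-+ k d) (F-step (d + k))
  where
  F-step : ∀ n → F n ≤ F (suc n)
  F-step zero = z≤n
  F-step (suc n) = m≤m+n (F (suc n)) (F n)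

F-mono : ∀ {k l} → k ≤ l → F k ≤ F l
F-mono {k} {l} k≤l = subst (λ n → F k ≤ F n) (m∸n+n≡m k≤l) (F-mono-+ k (l ∸ k))

0<F : ∀ k → 0 < F (suc k)
0<F k = F-mono {1} {suc k} (s≤s z≤n)

L-mono-+ : ∀ i d → L (suc i) ≤ L (suc (d + i))
L-mono-+ i zero = ≤-refl
L-mono-+ i (suc d) = ≤-trans (L-mono-+ i d) (m≤m+n (L (suc (d + i))) (L (d + i)))

L-mono : ∀ {i j} → i ≤ j → L (suc i) ≤ L (suc j)
L-mono {i} {j} i≤j = subst (λ n → L (suc i) ≤ L (suc n)) (m∸n+n≡m i≤j) (L-mono-+ i (j ∸ i))

0<L : ∀ n → 0 < L n
0<L zero = s≤s z≤n
0<L (suc n) = L-mono {0} {n} z≤n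

-- The extra 1 accounts for L 0 = 2 > 1 = L 1.
L-mono+1 : ∀ {i j} → i ≤ j → L i ≤ L j + 1
L-mono+1 {zero} {j} _ = +-monoˡ-≤ 1 (0<L j)
L-mono+1 {suc i} {suc j} (s≤s i≤j) = ≤-trans (L-mono i≤j) (m≤m+n (L (suc j)) 1)

L≤2L-suc : ∀ m → L m ≤ 2 * L (suc m)
L≤2L-suc zero = ≤-refl
L≤2L-suc (suc m) = ≤-trans (L-mono (n≤1+n m)) (m≤m+n (L (suc (suc m))) _)

L-suc≤3L : ∀ m → L (suc m) ≤ 3 * L m
L-suc≤3L zero = s≤s z≤n
L-suc≤3L (suc zero) = ≤-refl
L-suc≤3L (suc (suc m)) = ≤-trans (+-monoʳ-≤ (L (suc (suc m))) (L-mono (n≤1+n m))) (+-monoʳ-≤ (L (suc (suc m))) (m≤m+n (L (suc (suc m))) _))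

-- Size bounds confining u

F*L<L-upper : ∀ m c f f′ → 13 * c ≤ f′ → 8 * c ≤ f → 14 * (c * L m) ≤ f′ * L (suc m) + f * L m
F*L<L-upper m c f f′ c≤f′ c≤f = begin
  14 * (c * L m)                                ≡⟨ split c (L m) ⟩
  -- The numbers 13 and 8 are `F 7` and `F 6`. Of the 14 copies of `c * L m`, 8 are covered by `f`,
  -- and the other 6 cost at most 12 copies of `c * L (suc m)`; the factor 2 is attained at `m = 0`.
  6 * c * L m + 8 * c * L m                     ≤⟨ +-mono-≤ (*-monoʳ-≤ (6 * c) (L≤2L-suc m)) (*-monoˡ-≤ (L m) c≤f) ⟩
  6 * c * (2 * L (suc m)) + f * L m             ≤⟨ +-monoˡ-≤ (f * L m) (≤-trans (m≤m+n _ (c * L (suc m))) (≤-reflexive (collect c (L (suc m))))) ⟩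
  13 * c * L (suc m) + f * L m                  ≤⟨ +-monoˡ-≤ (f * L m) (*-monoˡ-≤ (L (suc m)) c≤f′) ⟩
  f′ * L (suc m) + f * L m                      ∎
  where
  open ≤-Reasoning
  split : ∀ c l → 14 * (c * l) ≡ 6 * c * l + 8 * c * l
  split = solve-∀
  collect : ∀ c l → 6 * c * (2 * l) + c * l ≡ 13 * c * l
  collect = solve-∀

-- With `f = F (suc k)` the right-hand side is at most 11 `f * L m`, whereas `L (m + (7 + k))` is at
-- least 14 `f * L m`. For the index `suc k` this means u ≤ 7.
upper-positive : ∀ n m k B → B ≤ 10 * F (suc k) → L n ≡ L m * B + F (suc k) → n < m + (7 + k)
upper-positive n m k B B≤ equation = ≰⇒> λ m+k≤n → <-irrefl refl (begin-strict
  L n                                              ≡⟨ equation ⟩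
  L m * B + f                                      ≤⟨ +-mono-≤ (*-monoʳ-≤ (L m) B≤) (m≤n*m f (L m) {{>-nonZero (0<L m)}}) ⟩
  L m * (10 * f) + L m * f                         ≡⟨ collect (L m) f ⟩
  11 * (f * L m)                                   <⟨ *-monoˡ-< (f * L m) {{>-nonZero (*-mono-≤ (0<F k) (0<L m))}} {11} {14} (m≤m+n 12 2) ⟩
  14 * (f * L m)                                   ≤⟨ F*L<L-upper m f (F (6 + k)) (F (7 + k)) (≤-trans (m≤m+n (13 * f) (8 * F k)) (≤-reflexive (unfold₇ f (F k)))) (≤-trans (m≤m+n (8 * f) (5 * F k)) (≤-reflexive (unfold₆ f (F k)))) ⟩
  F (7 + k) * L (suc m) + F (6 + k) * L m          ≡⟨ addition L L-like m (6 + k) ⟨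
  L (m + (7 + k))                                  ≡⟨ cong L (+-suc m (6 + k)) ⟩
  L (suc (m + (6 + k)))                            ≤⟨ monotone n (subst (_≤ n) (+-suc m (6 + k)) m+k≤n) ⟩
  L n                                              ∎)
  where
  open ≤-Reasoning
  f = F (suc k)
  monotone : ∀ {i} n → suc i ≤ n → L (suc i) ≤ L n
  monotone (suc n) (s≤s i≤n) = L-mono i≤n
  collect : ∀ l f → l * (10 * f) + l * f ≡ 11 * (f * l)
  collect = solve-∀
  unfold₆ : ∀ x y → 8 * x + 5 * y ≡ ((((x + y) + x) + (x + y)) + ((x + y) + x)) + (((x + y) + x) + (x + y))
  unfold₆ = solve-∀
  unfold₇ : ∀ x y → 13 * x + 8 * y ≡
    (((((x + y) + x) + (x + y)) + ((x + y) + x)) + (((x + y) + x) + (x + y))) + ((((x + y) + x) + (x + y)) + ((x + y) + x))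
  unfold₇ = solve-∀

upper-zero : ∀ n m B → B ≤ 10 → L n ≡ L m * B + 0 → n < m + 7
upper-zero n m B B≤ equation = ≰⇒> λ m+7≤n → <-irrefl refl (begin-strict
  L n                                              ≡⟨ trans equation (+-identityʳ (L m * B)) ⟩
  L m * B                                          ≤⟨ *-monoʳ-≤ (L m) B≤ ⟩
  L m * 10                                         ≡⟨ *-comm (L m) 10 ⟩
  10 * L m                                         <⟨ *-monoˡ-< (L m) {{>-nonZero (0<L m)}} {10} {14} (m≤m+n 11 3) ⟩
  14 * L m                                         ≡⟨ cong (14 *_) (sym (*-identityˡ (L m))) ⟩
  14 * (1 * L m)                                   ≤⟨ F*L<L-upper m 1 8 13 ≤-refl ≤-refl ⟩
  13 * L (suc m) + 8 * L m                         ≡⟨ addition L L-like m 6 ⟨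
  L (m + 7)                                        ≡⟨ cong L (+-suc m 6) ⟩
  L (suc (m + 6))                                  ≤⟨ monotone n (subst (_≤ n) (+-suc m 6) m+7≤n) ⟩
  L n                                              ∎)
  where
  open ≤-Reasoning
  monotone : ∀ {i} n → suc i ≤ n → L (suc i) ≤ L n
  monotone (suc n) (s≤s i≤n) = L-mono i≤n

-- Bounding `L (suc m)` by `3 * L m` in the addition formula leaves the factor 3 `F (suc j)` +
-- `F j`, and `F (4 + j)` is 3 `F (suc j)` + 2 `F j`.
L-+≤F*L : ∀ m y → L (m + y) ≤ F (3 + y) * L m
L-+≤F*L m zero = subst (λ n → L n ≤ 2 * L m) (sym (+-identityʳ m)) (m≤m+n (L m) _)
L-+≤F*L m (suc j) = begin
  L (m + suc j)                              ≡⟨ addition L L-like m j ⟩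
  x * L (suc m) + w * L m                    ≤⟨ +-mono-≤ (*-monoʳ-≤ x (L-suc≤3L m)) (m≤m+n (w * L m) (w * L m)) ⟩
  x * (3 * L m) + (w * L m + w * L m)        ≡⟨ collect x w (L m) ⟩
  F (4 + j) * L m                            ∎
  where
  open ≤-Reasoning
  x = F (suc j)
  w = F j
  collect : ∀ x w l → x * (3 * l) + (w * l + w * l) ≡ (((x + w) + x) + (x + w)) * l
  collect = solve-∀

-- Since `B` is at least `suc (F (3 + y))`, the right-hand side has a surplus of `L m + F (3 + y)`,
-- which beats the 1 lost in `L-mono+1`. With k = 3 + y the conclusion says u ≥ 0.
lower-large : ∀ n m y B → F (3 + y) < B → L n ≡ L m * B + F (3 + y) → m + y < n
lower-large n m y B F<B equation = ≰⇒> λ n≤m+y → <-irrefl refl (begin-strict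
  L n                          ≤⟨ L-mono+1 n≤m+y ⟩
  L (m + y) + 1                ≤⟨ +-monoˡ-≤ 1 (L-+≤F*L m y) ⟩
  f * L m + 1                  <⟨ +-mono-≤-< {f * L m} {L m * f} (≤-reflexive (*-comm f (L m))) (+-mono-≤ (0<L m) (0<F (2 + y))) ⟩
  L m * f + (L m + f)          ≡⟨ collect (L m) f ⟩
  L m * suc f + f              ≤⟨ +-monoˡ-≤ f (*-monoʳ-≤ (L m) F<B) ⟩
  L m * B + f                  ≡⟨ equation ⟨
  L n                          ∎)
  where
  open ≤-Reasoning
  f = F (3 + y)
  collect : ∀ l f → l * f + (l + f) ≡ l * suc f + f
  collect = solve-∀

lower-positive : ∀ n m k B → 2 ≤ B → L n ≡ L m * B + F (suc k) → m ≤ n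
lower-positive n m k B 2≤B equation = ≮⇒≥ λ n<m → <-irrefl refl (begin-strict
  L n                    ≤⟨ L-mono+1 (<⇒≤ n<m) ⟩
  L m + 1                <⟨ +-monoʳ-< (L m) {1} {L m + F (suc k)} (+-mono-≤ (0<L m) (0<F k)) ⟩
  L m + (L m + F (suc k)) ≡⟨ collect (L m) (F (suc k)) ⟩
  L m * 2 + F (suc k)    ≤⟨ +-monoˡ-≤ (F (suc k)) (*-monoʳ-≤ (L m) 2≤B) ⟩
  L m * B + F (suc k)    ≡⟨ equation ⟨
  L n                    ∎)
  where
  open ≤-Reasoning
  collect : ∀ l f → l + (l + f) ≡ l * 2 + f
  collect = solve-∀

-- The bound `m ≤ n` would be false: `L 0` is twice `L 1`.
lower-zero : ∀ n m B → 2 ≤ B → L n ≡ L m * B + 0 → m ≤ suc n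
lower-zero n zero B 2≤B equation = z≤n
lower-zero n (suc zero) B 2≤B equation = s≤s z≤n
lower-zero n (suc (suc m)) B 2≤B equation = ≮⇒≥ λ n<m → <-irrefl refl (begin-strict
  L n                    ≤⟨ L-mono+1 (≤-trans (n≤1+n n) (<⇒≤ n<m)) ⟩
  L (2 + m) + 1          <⟨ +-monoʳ-< (L (2 + m)) {1} {L (2 + m)} (≤-trans (m≤m+n 2 1) (L-mono {1} {suc m} (s≤s z≤n))) ⟩
  L (2 + m) + L (2 + m)  ≡⟨ collect (L (2 + m)) ⟩
  L (2 + m) * 2          ≤⟨ *-monoʳ-≤ (L (2 + m)) 2≤B ⟩
  L (2 + m) * B          ≡⟨ trans equation (+-identityʳ (L (2 + m) * B)) ⟨
  L n                    ∎)
  where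
  open ≤-Reasoning
  collect : ∀ l → l + l ≡ l * 2
  collect = solve-∀

-- Divisors of s² + 1 and the descent obstruction

skip-two : ∀ X → FibonacciLike X → ∀ n → X (4 + n) + X n ≡ 3 * X (2 + n)
skip-two X X-like n
  rewrite X-like (2 + n) | X-like (1 + n) | X-like n = expand (X (1 + n)) (X n)
  where
  expand : ∀ a b → (((a + b) + a) + (a + b)) + b ≡ 3 * (a + b)
  expand = solve-∀

-- The identity L h · X t = X (t + h) + (-1)^h X (t - h), restricted to even h to fix the sign and
-- shifted by t = h + x to avoid subtraction.
EvenProduct : (ℕ → ℕ) → ℕ → Set
EvenProduct X i = ∀ x → L (i * 2) * X (i * 2 + x) ≡ X (i * 2 + (i * 2 + x)) + X x

-- Both `L` and `X` satisfy the recurrence of `skip-two`. With the common factor `A`, three times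
-- the identity for `2 + j` is therefore the sum of those for `j` and `4 + j`; the one for `j` is
-- cancelled.
even-product-step : ∀ X → FibonacciLike X → ∀ i → EvenProduct X i → EvenProduct X (1 + i) → EvenProduct X (2 + i)
even-product-step X X-like i at-i at-1+i x = +-cancelʳ-≡ (L j * A) _ _ (begin
  L (4 + j) * A + L j * A                                 ≡⟨ sym (*-distribʳ-+ A (L (4 + j)) (L j)) ⟩
  (L (4 + j) + L j) * A                                   ≡⟨ cong (_* A) (skip-two L L-like j) ⟩
  3 * L (2 + j) * A                                       ≡⟨ *-assoc 3 (L (2 + j)) A ⟩
  3 * (L (2 + j) * A)                                     ≡⟨ cong (3 *_) first ⟩
  3 * (X (2 + (4 + t)) + X (2 + x))                       ≡⟨ *-distribˡ-+ 3 (X (2 + (4 + t))) (X (2 + x)) ⟩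
  3 * X (2 + (4 + t)) + 3 * X (2 + x)                     ≡⟨ cong₂ _+_ (sym (skip-two X X-like (4 + t))) (sym (skip-two X X-like x)) ⟩
  (X (8 + t) + X (4 + t)) + (X (4 + x) + X x)             ≡⟨ regroup (X (8 + t)) (X (4 + t)) (X (4 + x)) (X x) ⟩
  (X (8 + t) + X x) + (X (4 + t) + X (4 + x))             ≡⟨ cong₂ _+_ (cong (λ n → X n + X x) (index₄ j x)) (sym second) ⟩
  (X ((4 + j) + ((4 + j) + x)) + X x) + L j * A           ∎)
  where
  open ≡-Reasoning
  j = i * 2
  t = j + (j + x)
  A = X ((4 + j) + x)
  regroup : ∀ a b c d → (a + b) + (c + d) ≡ (a + d) + (b + c)
  regroup = solve-∀
  index₁ : ∀ j x → (2 + j) + (2 + x) ≡ (4 + j) + x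
  index₁ = solve-∀
  index₂ : ∀ j x → (2 + j) + ((2 + j) + (2 + x)) ≡ 6 + (j + (j + x))
  index₂ = solve-∀
  index₃ : ∀ j x → j + (4 + x) ≡ (4 + j) + x
  index₃ = solve-∀
  index₄ : ∀ j x → 8 + (j + (j + x)) ≡ (4 + j) + ((4 + j) + x)
  index₄ = solve-∀
  index₅ : ∀ j x → j + (j + (4 + x)) ≡ 4 + (j + (j + x))
  index₅ = solve-∀
  first : L (2 + j) * A ≡ X (6 + t) + X (2 + x)
  first = subst₂ (λ p q → L (2 + j) * X p ≡ X q + X (2 + x)) (index₁ j x) (index₂ j x) (at-1+i (2 + x))
  second : L j * A ≡ X (4 + t) + X (4 + x)
  second = subst₂ (λ p q → L j * X p ≡ X q + X (4 + x)) (index₃ j x) (index₅ j x) (at-i (4 + x))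

even-product : ∀ X → FibonacciLike X → ∀ i → EvenProduct X i
even-product X X-like zero x = twice (X x)
  where
  twice : ∀ a → 2 * a ≡ a + a
  twice = solve-∀
even-product X X-like (suc zero) x = sym (skip-two X X-like x)
even-product X X-like (suc (suc i)) = even-product-step X X-like i (even-product X X-like i) (even-product X X-like (suc i))

-- The congruence X (T + x) ≡ - X x, written as a sum to stay within the naturals.
Antiperiod : ℕ → (ℕ → ℕ) → ℕ → Set
Antiperiod e X T = ∀ x → e ∣ X x + X (T + x)

-- In `even-product` the left-hand side vanishes modulo `e`, so the two terms on the right are
-- opposite.
antiperiod : ∀ X → FibonacciLike X → ∀ {e} i → e ∣ L (i * 2) → Antiperiod e X (i * 2 * 2)
antiperiod X X-like {e} i e∣L x =
  subst (e ∣_) (trans (even-product X X-like i x) (trans (+-comm (X (i * 2 + (i * 2 + x))) (X x)) (cong (λ y → X x + X y) (index (i * 2) x))))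
    (∣m⇒∣m*n (X (i * 2 + x)) e∣L)
  where
  index : ∀ h x → h + (h + x) ≡ h * 2 + x
  index = solve-∀

-- Each additional pair of shifts by `T` changes the sign twice.
odd-multiple : ∀ X T {e} → Antiperiod e X T → ∀ c → Antiperiod e X (T + c * (T + T))
odd-multiple X T {e} anti zero x = subst (λ y → e ∣ X x + X (y + x)) (sym (+-identityʳ T)) (anti x)
odd-multiple X T {e} anti (suc c) x =
  subst (λ z → e ∣ X x + X z) (index T (c * (T + T)) x)
    (∣m+n∣m⇒∣n
      (subst (e ∣_) (regroup (X x) (X y) (X (T + y)) (X (T + (T + y))))
        (∣m∣n⇒∣m+n (odd-multiple X T anti c x) (anti (T + y))))
      (anti y))
  where
  y = T + c * (T + T) + x
  index : ∀ T d x → T + (T + (T + d + x)) ≡ T + ((T + T) + d) + x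
  index = solve-∀
  regroup : ∀ a b c d → (a + b) + (c + d) ≡ (b + c) + (a + d)
  regroup = solve-∀

parity : ∀ n → (∃ λ c → n ≡ c * 2) ⊎ (∃ λ c → n ≡ 1 + c * 2)
parity n with n % 2 | m%n<n n 2 | m≡m%n+[m/n]*n n 2
... | zero | _ | eq = inj₁ (n / 2 , eq)
... | suc zero | _ | eq = inj₂ (n / 2 , eq)
... | suc (suc _) | s≤s (s≤s ()) | _

odd-part : ∀ n → 0 < n → ∃₂ λ i c → n ≡ 2 ^ i * (1 + c * 2)
odd-part = <-rec (λ n → 0 < n → ∃₂ λ i c → n ≡ 2 ^ i * (1 + c * 2)) go
  where
  go : ∀ n → (∀ {m} → m < n → 0 < m → ∃₂ λ i c → m ≡ 2 ^ i * (1 + c * 2)) → 0 < n → ∃₂ λ i c → n ≡ 2 ^ i * (1 + c * 2)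
  go n rec 0<n with parity n
  ... | inj₂ (c , eq) = 0 , c , trans eq (sym (*-identityˡ (1 + c * 2)))
  go .(suc c * 2) rec 0<n | inj₁ (suc c , refl) with rec (s≤s (s≤s (m≤m*n c 2))) (s≤s z≤n)
  ... | i , d , eq = suc i , d , trans (cong (_* 2) eq) (pull (2 ^ i) (1 + d * 2))
    where
    pull : ∀ p q → p * q * 2 ≡ 2 * p * q
    pull = solve-∀

∣-shift-square : ∀ {N} r t → N ∣ (r + t * N) * (r + t * N) + 1 → N ∣ r * r + 1
∣-shift-square {N} r t N∣ = ∣m+n∣m⇒∣n (subst (N ∣_) (expand N r t) N∣) (m∣m*n (2 * r * t + t * t * N))
  where
  expand : ∀ N r t → (r + t * N) * (r + t * N) + 1 ≡ N * (2 * r * t + t * t * N) + (r * r + 1)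
  expand = solve-∀

∣-complement-square : ∀ {N} r t → r + t ≡ N → N ∣ r * r + 1 → N ∣ t * t + 1
∣-complement-square r t refl N∣ =
  ∣m+n∣m⇒∣n (subst (r + t ∣_) (exchange r t) (∣m∣n⇒∣m+n N∣ (m∣m*n t))) (m∣m*n r)
  where
  exchange : ∀ r t → (r * r + 1) + (r + t) * t ≡ (r + t) * r + (t * t + 1)
  exchange = solve-∀

-- Fermat descent: a divisor N ≡ 3 (mod 4) of s² + 1 with s even and s < N has a smaller cofactor, again ≡ 3 (mod 4).
3mod4∤square+1 : ∀ q y → ¬ 3 + q * 4 ∣ y * y + 1
3mod4∤square+1 = <-rec (λ q → ∀ y → ¬ 3 + q * 4 ∣ y * y + 1) go
  where
  go : ∀ q → (∀ {q′} → q′ < q → ∀ y → ¬ 3 + q′ * 4 ∣ y * y + 1) → ∀ y → ¬ 3 + q * 4 ∣ y * y + 1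
  go q rec y N∣ = reduce (y % N) (m%n<n y N) (∣-shift-square (y % N) (y / N) (subst (λ z → N ∣ z * z + 1) (m≡m%n+[m/n]*n y N) N∣))
    where
    N = 3 + q * 4
    descend : ∀ s → s * 2 < N → ¬ N ∣ s * 2 * (s * 2) + 1
    descend s 2s<N (divides N′ eq) with N′ % 4 | m%n<n N′ 4 | m≡m%n+[m/n]*n N′ 4
    ... | c | c<4 | N′≡ = cofactor c c<4 (N′ / 4) N′≡
      where
      residue : ∀ c z → N′ ≡ c + z * 4 → (3 * c) % 4 ≡ 1
      residue c z N′≡ = begin
        (3 * c) % 4                                         ≡⟨ [m+kn]%n≡m%n (3 * c) (q * c + z * N) 4 ⟨
        (3 * c + (q * c + z * N) * 4) % 4                   ≡⟨ cong (_% 4) (collect q c z) ⟩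
        ((c + z * 4) * N) % 4                               ≡⟨ cong (λ n → (n * N) % 4) (sym N′≡) ⟩
        (N′ * N) % 4                                        ≡⟨ cong (_% 4) (sym eq) ⟩
        (s * 2 * (s * 2) + 1) % 4                           ≡⟨ cong (_% 4) (square s) ⟩
        (1 + s * s * 4) % 4                                 ≡⟨ [m+kn]%n≡m%n 1 (s * s) 4 ⟩
        1                                                   ∎
        where
        open ≡-Reasoning
        collect : ∀ q c z → 3 * c + (q * c + z * (3 + q * 4)) * 4 ≡ (c + z * 4) * (3 + q * 4)
        collect = solve-∀
        square : ∀ s → s * 2 * (s * 2) + 1 ≡ 1 + s * s * 4
        square = solve-∀
      cofactor : ∀ c → c < 4 → ∀ z → N′ ≡ c + z * 4 → ⊥
      cofactor 0 _ z N′≡ with () ← residue 0 z N′≡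
      cofactor 1 _ z N′≡ with () ← residue 1 z N′≡
      cofactor 2 _ z N′≡ with () ← residue 2 z N′≡
      cofactor 3 _ z N′≡ = rec z<q (s * 2) (subst (_∣ s * 2 * (s * 2) + 1) N′≡ (divides N (trans eq (*-comm N′ N))))
        where
        open ≤-Reasoning
        small : s * 2 * (s * 2) + 1 < N * N
        small = begin-strict
          s * 2 * (s * 2) + 1           <⟨ +-monoʳ-< (s * 2 * (s * 2)) {1} {3 + s * 2} (s≤s (s≤s z≤n)) ⟩
          s * 2 * (s * 2) + (3 + s * 2) ≡⟨ factor (s * 2) ⟩
          s * 2 * suc (s * 2) + 3       ≤⟨ +-mono-≤ (*-monoʳ-≤ (s * 2) 2s<N) (m≤m+n 3 (q * 4)) ⟩
          s * 2 * N + N                 ≡⟨ +-comm (s * 2 * N) N ⟩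
          suc (s * 2) * N               ≤⟨ *-monoˡ-≤ N 2s<N ⟩
          N * N                         ∎
          where
          factor : ∀ a → a * a + (3 + a) ≡ a * suc a + 3
          factor = solve-∀
        N′<N : N′ < N
        N′<N = *-cancelʳ-< N N′ N (subst (_< N * N) eq small)
        z<q : z < q
        z<q = *-cancelʳ-< 4 z q (+-cancelˡ-< 3 (z * 4) (q * 4) (subst (_< N) N′≡ N′<N))
      cofactor (suc (suc (suc (suc _)))) (s≤s (s≤s (s≤s (s≤s ())))) z N′≡
    reduce : ∀ r → r < N → ¬ N ∣ r * r + 1
    reduce r r<N N∣r with parity r
    ... | inj₁ (s , refl) = descend s r<N N∣r
    -- `N` is odd, so an odd remainder r is replaced by the even number N - r, which is -r modulo
    -- `N`.
    ... | inj₂ (s , refl) = descend s′ (+-cancelˡ-< r (s′ * 2) N (subst (_< r + N) (sym r+2s′) (m<n+m N (s≤s z≤n)))) (∣-complement-square r (s′ * 2) r+2s′ N∣r)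
      where
      s′ = 1 + q * 2 ∸ s
      s≤ : s ≤ 1 + q * 2
      s≤ = *-cancelʳ-≤ s (1 + q * 2) 2 (+-cancelˡ-≤ 1 _ _ (subst (1 + s * 2 ≤_) (double q) (<⇒≤ r<N)))
        where
        double : ∀ q → 3 + q * 4 ≡ 1 + (1 + q * 2) * 2
        double = solve-∀
      r+2s′ : 1 + s * 2 + s′ * 2 ≡ N
      r+2s′ = begin
        1 + s * 2 + s′ * 2      ≡⟨ cong suc (sym (*-distribʳ-+ 2 s s′)) ⟩
        1 + (s + s′) * 2        ≡⟨ cong (λ n → 1 + n * 2) (m+[n∸m]≡n s≤) ⟩
        1 + (1 + q * 2) * 2     ≡⟨ double q ⟩
        N                       ∎
        where
        open ≡-Reasoning
        double : ∀ q → 1 + (1 + q * 2) * 2 ≡ 3 + q * 4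
        double = solve-∀

-- For even h, `even-product` at 0 reads L (2h) + 2 = (L h)², and 3² - 2 ≡ 3 modulo 4; the start is
-- `L 2`, which is 3.
L-2^-mod4 : ∀ j → ∃ λ q → L (2 ^ j * 2) ≡ 3 + q * 4
L-2^-mod4 zero = 0 , refl
L-2^-mod4 (suc j) with L-2^-mod4 j
... | q , eq = 1 + 6 * q + 4 * q * q , +-cancelʳ-≡ 2 _ _ (begin
  L (2 * 2 ^ j * 2) + 2               ≡⟨ cong (λ n → L n + 2) (index (2 ^ j)) ⟩
  L (h + (h + 0)) + 2                 ≡⟨ sym (even-product L L-like (2 ^ j) 0) ⟩
  L h * L (h + 0)                     ≡⟨ cong (λ n → L h * L n) (+-identityʳ h) ⟩
  L h * L h                           ≡⟨ cong₂ _*_ eq eq ⟩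
  (3 + q * 4) * (3 + q * 4)           ≡⟨ expand q ⟩
  3 + (1 + 6 * q + 4 * q * q) * 4 + 2 ∎)
  where
  open ≡-Reasoning
  h = 2 ^ j * 2
  index : ∀ n → 2 * n * 2 ≡ n * 2 + (n * 2 + 0)
  index = solve-∀
  expand : ∀ q → (3 + q * 4) * (3 + q * 4) ≡ 3 + (1 + 6 * q + 4 * q * q) * 4 + 2
  expand = solve-∀

even-power : ∀ i → ∃ λ d → 2 ^ (1 + i) ≡ 2 + d * 2
even-power zero = 0 , refl
even-power (suc i) with even-power i
... | d , eq = 1 + d * 2 , trans (cong (2 *_) eq) (step d)
  where
  step : ∀ d → 2 * (2 + d * 2) ≡ 2 + (1 + d * 2) * 2
  step = solve-∀

-- Both sides of the equation are an index N with X (x + N) ≡ - X x and with X (x + N) ≡ X x (mod e), so e divides 2 L₀.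
antiperiods-clash : ∀ {e T S} c d → Antiperiod e L T → Antiperiod e L S → T * (1 + c * 2) ≡ (2 + d * 2) * S → e ∣ 4
antiperiods-clash {e} {T} {S} c d T-anti S-anti eq = ∣m+n∣m⇒∣n sum (S-anti y)
  where
  y = S + d * (S + S) + 0
  same : T + c * (T + T) + 0 ≡ S + y
  same = trans (odd T c) (trans eq (even S d))
    where
    odd : ∀ T c → T + c * (T + T) + 0 ≡ T * (1 + c * 2)
    odd = solve-∀
    even : ∀ S d → (2 + d * 2) * S ≡ S + (S + d * (S + S) + 0)
    even = solve-∀
  sum : e ∣ (L y + L (S + y)) + 4
  sum = subst (e ∣_) (regroup (L y) (L (S + y)))
    (∣m∣n⇒∣m+n (subst (λ n → e ∣ 2 + L n) same (odd-multiple L T T-anti c 0)) (odd-multiple L S S-anti d 0))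
    where
    regroup : ∀ p q → (2 + q) + (2 + p) ≡ (p + q) + 4
    regroup = solve-∀

-- The first index contains more factors 2 than the second, so an odd multiple of one antiperiod is
-- an even multiple of the other and a common divisor divides 4. It also divides a number ≡ 3 modulo
-- 4, hence 3, hence 1.
L-coprime : ∀ a i c → Coprime (L (2 ^ (1 + i + a) * 2)) (L (2 ^ a * (1 + c * 2) * 2))
L-coprime a i c {e} (e∣Lh , e∣Lm) = ∣1⇒≡1 (∣m+n∣m⇒∣n e∣4 (∣m+n∣m⇒∣n (subst (e ∣_) (trans (proj₂ odd-Lh) (+-comm 3 (proj₁ odd-Lh * 4))) e∣Lh) (∣n⇒∣m*n (proj₁ odd-Lh) e∣4)))
  where
  odd-Lh = L-2^-mod4 (1 + i + a)
  d = proj₁ (even-power i)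
  W = 1 + c * 2
  balance : 2 ^ (1 + i + a) * 2 * 2 * W ≡ (2 + d * 2) * (2 ^ a * W * 2 * 2)
  balance = begin
    2 ^ (1 + i + a) * 2 * 2 * W                ≡⟨ cong (λ p → p * 2 * 2 * W) (^-distribˡ-+-* 2 (1 + i) a) ⟩
    2 ^ (1 + i) * 2 ^ a * 2 * 2 * W            ≡⟨ exchange (2 ^ (1 + i)) (2 ^ a) W ⟩
    2 ^ (1 + i) * (2 ^ a * W * 2 * 2)          ≡⟨ cong (_* (2 ^ a * W * 2 * 2)) (proj₂ (even-power i)) ⟩
    (2 + d * 2) * (2 ^ a * W * 2 * 2)          ∎
    where
    open ≡-Reasoning
    exchange : ∀ B A W → B * A * 2 * 2 * W ≡ B * (A * W * 2 * 2)
    exchange = solve-∀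
  e∣4 : e ∣ 4
  e∣4 = antiperiods-clash {T = 2 ^ (1 + i + a) * 2 * 2} {S = 2 ^ a * W * 2 * 2} c d
    (antiperiod L L-like (2 ^ (1 + i + a)) e∣Lh) (antiperiod L L-like (2 ^ a * W) e∣Lm) balance

-- Modulo `e`, `F k` is - `F 0`, which is 0, and `L (m + k)` is - `L m`; so the equation makes
-- `L m * (B + 1)` vanish.
antiperiod-divides : ∀ e m k B → (∀ X → FibonacciLike X → Antiperiod e X k) → Coprime e (L m) →
  L (m + k) ≡ L m * B + F k → e ∣ B + 1
antiperiod-divides e m k B anti coprime equation = coprime-divisor coprime (∣m+n∣m⇒∣n {m = F k} sum e∣Fk)
  where
  e∣Fk : e ∣ F k
  e∣Fk = subst (λ n → e ∣ F n) (+-identityʳ k) (anti F F-like 0)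
  collect : ∀ l p f → l + (l * p + f) ≡ f + l * (p + 1)
  collect = solve-∀
  sum : e ∣ F k + L m * (B + 1)
  sum = subst (e ∣_) (trans (cong (L m +_) (trans (cong L (+-comm k m)) equation)) (collect (L m) B (F k))) (anti L L-like m)

-- Here `k` is an odd multiple of 2h for the power of two `h`, and `h` contains more factors 2 than
-- `m`. Thus `L h` would divide a square plus 1.
descent-obstruction-core : ∀ a i c g b d → let m = 2 ^ a * (1 + c * 2) * 2; k = 2 ^ i * (1 + g * 2) * 2 ^ (3 + a) in
  ¬ L (m + k) ≡ L m * b ^ (d * 2) + F k
descent-obstruction-core a i c g b d equation =
  3mod4∤square+1 (proj₁ odd-Lh) (b ^ d)
    (subst₂ _∣_ (proj₂ odd-Lh) (cong (_+ 1) square)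
      (antiperiod-divides (L h) m k (b ^ (d * 2)) anti (L-coprime a i c) equation))
  where
  h = 2 ^ (1 + i + a) * 2
  m = 2 ^ a * (1 + c * 2) * 2
  k = 2 ^ i * (1 + g * 2) * 2 ^ (3 + a)
  odd-Lh = L-2^-mod4 (1 + i + a)
  k≡ : h * 2 + g * (h * 2 + h * 2) ≡ k
  k≡ = begin
    h * 2 + g * (h * 2 + h * 2)              ≡⟨ odd (h * 2) g ⟩
    h * 2 * (1 + g * 2)                      ≡⟨ cong (λ p → 2 * p * 2 * 2 * (1 + g * 2)) (^-distribˡ-+-* 2 i a) ⟩
    2 * (2 ^ i * 2 ^ a) * 2 * 2 * (1 + g * 2)  ≡⟨ exchange (2 ^ i) (2 ^ a) (1 + g * 2) ⟩
    k                                        ∎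
    where
    open ≡-Reasoning
    odd : ∀ T g → T + g * (T + T) ≡ T * (1 + g * 2)
    odd = solve-∀
    exchange : ∀ p q w → 2 * (p * q) * 2 * 2 * w ≡ p * w * (2 * (2 * (2 * q)))
    exchange = solve-∀
  anti : ∀ X → FibonacciLike X → Antiperiod (L h) X k
  anti X X-like = subst (Antiperiod (L h) X) k≡
    (odd-multiple X (h * 2) (antiperiod X X-like {e = L h} (2 ^ (1 + i + a)) ∣-refl) g)
  square : b ^ (d * 2) ≡ b ^ d * b ^ d
  square = trans (sym (^-*-assoc b d 2)) (cong (b ^ d *_) (*-identityʳ (b ^ d)))

-- The conditions on `4 * m` and `2 * m` say that the 2-adic valuation of `m` is `a + 1`, in a form
-- visible modulo `2 ^ (3 + a)`. Positivity of `k` excludes the trivial solution k = d = 0.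
descent-obstruction : ∀ a m k b d → 0 < k → L (m + k) ≡ L m * b ^ d + F k →
  2 ^ (3 + a) ∣ 4 * m → ¬ 2 ^ (3 + a) ∣ 2 * m → 2 ^ (3 + a) ∣ k → ¬ 2 ∣ d
descent-obstruction a m k b d 0<k equation (divides w 4m≡) ∤2m (divides k′ k≡) (divides d′ d≡) with parity w
... | inj₁ (w′ , w≡) = ∤2m (divides w′ (*-cancelˡ-≡ (2 * m) _ 2 (trans (shape₁ m) (trans 4m≡ (trans (cong (_* 2 ^ (3 + a)) w≡) (shape₂ w′ (2 ^ (3 + a))))))))
  where
  shape₁ : ∀ m → 2 * (2 * m) ≡ 4 * m
  shape₁ = solve-∀
  shape₂ : ∀ w p → w * 2 * p ≡ 2 * (w * p)
  shape₂ = solve-∀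
... | inj₂ (c , w≡) with odd-part k′ (positive k′ k≡)
  where
  positive : ∀ k′ → k ≡ k′ * 2 ^ (3 + a) → 0 < k′
  positive zero k≡0 = subst (0 <_) k≡0 0<k
  positive (suc _) _ = s≤s z≤n
... | i , g , k′≡ = descent-obstruction-core a i c g b d′ (substituted m≡ (trans k≡ (cong (_* 2 ^ (3 + a)) k′≡)) d≡ equation)
  where
  m≡ : m ≡ 2 ^ a * (1 + c * 2) * 2
  m≡ = *-cancelˡ-≡ m _ 4 (trans 4m≡ (trans (cong (_* 2 ^ (3 + a)) w≡) (shape (2 ^ a) (1 + c * 2))))
    where
    shape : ∀ p w → w * (2 * (2 * (2 * p))) ≡ 4 * (p * w * 2)
    shape = solve-∀
  substituted : ∀ {m₁ k₁ d₁} → m ≡ m₁ → k ≡ k₁ → d ≡ d₁ → L (m + k) ≡ L m * b ^ d + F k → L (m₁ + k₁) ≡ L m₁ * b ^ d₁ + F k₁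
  substituted refl refl refl eq = eq

-- Residues of Fibonacci numbers and powers

≡ᵇ-sound : ∀ {m n} → (m ≡ᵇ n) ≡ true → m ≡ n
≡ᵇ-sound {m} {n} eq = ≡ᵇ⇒≡ m n (Equivalence.from T-≡ eq)

≡ᵇ-complete : ∀ {m n} → m ≡ n → (m ≡ᵇ n) ≡ true
≡ᵇ-complete {m} {n} eq = Equivalence.to T-≡ (≡⇒≡ᵇ m n eq)

∧-true : ∀ {a b} → a ∧ b ≡ true → a ≡ true × b ≡ true
∧-true {true} eq = refl , eq

module Congruence (M : ℕ) {{M≢0 : NonZero M}} where

  infix 4 _≈_
  _≈_ : ℕ → ℕ → Set
  a ≈ b = a % M ≡ b % M

  %-≈ : ∀ a → a % M ≈ a
  %-≈ a = m%n%n≡m%n a M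

  +-≈ : ∀ {a a′ b b′} → a ≈ a′ → b ≈ b′ → a + b ≈ a′ + b′
  +-≈ {a} {a′} {b} {b′} p q =
    trans (%-distribˡ-+ a b M) (trans (cong₂ (λ x y → (x + y) % M) p q) (sym (%-distribˡ-+ a′ b′ M)))

  *-≈ : ∀ {a a′ b b′} → a ≈ a′ → b ≈ b′ → a * b ≈ a′ * b′
  *-≈ {a} {a′} {b} {b′} p q =
    trans (%-distribˡ-* a b M) (trans (cong₂ (λ x y → (x * y) % M) p q) (sym (%-distribˡ-* a′ b′ M)))

  next : ℕ × ℕ → ℕ × ℕ
  next (a , a′) = a′ , (a′ + a) % M

  -- Sends the pair at index h to the pair at 2h + 1, not 2h: the formulas for `F (2h + 1)` and
  -- `F (2h + 2)` contain no subtraction.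
  double : ℕ × ℕ → ℕ × ℕ
  double (a , a′) = (a′ * a′ + a * a) % M , ((a′ + a) * a′ + a′ * a) % M

  -- The first argument bounds the number of halvings; beyond it the recursion is linear.
  fib : ℕ → ℕ → ℕ × ℕ
  fib-halved : ℕ → ℕ → Bool → ℕ × ℕ
  fib t zero = 0 % M , 1 % M
  fib zero (suc n) = next (fib zero n)
  fib (suc t) (suc n) = fib-halved t (n / 2) (n % 2 ≡ᵇ 0)
  fib-halved t h true = double (fib t h)
  fib-halved t h false = next (double (fib t h))

  power : ℕ → ℕ → ℕ → ℕ
  power-halved : ℕ → ℕ → ℕ → Bool → ℕ
  square : ℕ → ℕ
  square x = (x * x) % M
  power t b zero = 1 % M
  power zero b (suc n) = (b * power zero b n) % M
  power (suc t) b (suc n) = power-halved t b (n / 2) (n % 2 ≡ᵇ 0)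
  power-halved t b h true = (b * square (power t b h)) % M
  power-halved t b h false = square (b * power t b h)

  reduced : ℕ → ℕ × ℕ
  reduced n = F n % M , F (suc n) % M

  next-reduced : ∀ n → next (reduced n) ≡ reduced (suc n)
  next-reduced n = cong (F (suc n) % M ,_) (+-≈ (%-≈ (F (suc n))) (%-≈ (F n)))

  double-reduced : ∀ h → double (reduced h) ≡ reduced (suc (h * 2))
  double-reduced h = cong₂ _,_
    (trans (+-≈ (*-≈ f′ f′) (*-≈ f f)) (cong (_% M) (trans (sym (addition F F-like h h)) (cong F twice))))
    (trans (+-≈ (*-≈ (+-≈ f′ f) f′) (*-≈ f′ f))
      (cong (_% M) (trans (sym (addition F F-like h (suc h))) (cong F (trans (+-suc h (suc h)) (cong suc twice))))))
    where
    f = %-≈ (F h)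
    f′ = %-≈ (F (suc h))
    odd : ∀ h → h + suc h ≡ suc (h * 2)
    odd = solve-∀
    twice = odd h

  fib-correct : ∀ t n → fib t n ≡ reduced n
  fib-halved-correct : ∀ t h r → r < 2 → fib-halved t h (r ≡ᵇ 0) ≡ reduced (suc (r + h * 2))
  fib-correct t zero = refl
  fib-correct zero (suc n) = trans (cong next (fib-correct zero n)) (next-reduced n)
  fib-correct (suc t) (suc n) =
    trans (fib-halved-correct t (n / 2) (n % 2) (m%n<n n 2)) (cong (λ m → reduced (suc m)) (sym (m≡m%n+[m/n]*n n 2)))
  fib-halved-correct t h zero _ = trans (cong double (fib-correct t h)) (double-reduced h)
  fib-halved-correct t h (suc zero) _ =
    trans (cong (λ p → next (double p)) (fib-correct t h)) (trans (cong next (double-reduced h)) (next-reduced (suc (h * 2))))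
  fib-halved-correct t h (suc (suc r)) (s≤s (s≤s ()))

  power-correct : ∀ t b n → power t b n ≡ (b ^ n) % M
  power-halved-correct : ∀ t b h r → r < 2 → power-halved t b h (r ≡ᵇ 0) ≡ (b ^ suc (r + h * 2)) % M
  power-correct t b zero = refl
  power-correct zero b (suc n) = *-≈ {b} refl (trans (cong (_% M) (power-correct zero b n)) (%-≈ (b ^ n)))
  power-correct (suc t) b (suc n) =
    trans (power-halved-correct t b (n / 2) (n % 2) (m%n<n n 2)) (cong (λ m → (b ^ suc m) % M) (sym (m≡m%n+[m/n]*n n 2)))
  power-halved-correct t b h zero _ =
    trans (*-≈ {b} refl (trans (%-≈ _) (*-≈ p p))) (cong (λ c → (b * c) % M) (trans (sym (^-distribˡ-+-* b h h)) (cong (b ^_) (double-sum h))))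
    where
    p = trans (cong (_% M) (power-correct t b h)) (%-≈ (b ^ h))
    double-sum : ∀ h → h + h ≡ h * 2
    double-sum = solve-∀
  power-halved-correct t b h (suc zero) _ =
    trans (*-≈ (*-≈ {b} refl p) (*-≈ {b} refl p)) (cong (_% M) (trans (sym (^-distribˡ-+-* b (suc h) (suc h))) (cong (b ^_) (double-sum h))))
    where
    p = trans (cong (_% M) (power-correct t b h)) (%-≈ (b ^ h))
    double-sum : ∀ h → suc h + suc h ≡ suc (suc (h * 2))
    double-sum = solve-∀
  power-halved-correct t b h (suc (suc r)) (s≤s (s≤s ()))

  -- One returning pair of consecutive residues propagates by the recurrence; any multiple of the
  -- Pisano period qualifies.
  IsPeriod : ℕ → Set
  IsPeriod N = reduced N ≡ reduced 0

  F-periodic : ∀ {N} → IsPeriod N → ∀ c x → F (x + c * N) ≈ F x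
  F-periodic {N} per zero x = cong (λ y → F y % M) (+-identityʳ x)
  F-periodic {N} per (suc c) x =
    trans (cong (λ y → F y % M) (rearrange x N (c * N))) (trans (once (x + c * N)) (F-periodic per c x))
    where
    rearrange : ∀ x n m → x + (n + m) ≡ (x + m) + n
    rearrange = solve-∀
    once : ∀ x → F (x + N) ≈ F x
    once zero = cong proj₁ per
    once (suc zero) = cong proj₂ per
    once (suc (suc x)) = +-≈ (once (suc x)) (once x)

  ^-periodic : ∀ {b D} → b ^ D ≈ 1 → ∀ c z → b ^ (z + c * D) ≈ b ^ z
  ^-periodic {b} {D} per c z = begin
    b ^ (z + c * D) % M           ≡⟨ cong (_% M) (^-distribˡ-+-* b z (c * D)) ⟩
    (b ^ z * b ^ (c * D)) % M     ≡⟨ *-≈ {b ^ z} refl (one c) ⟩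
    (b ^ z * 1) % M               ≡⟨ cong (_% M) (*-identityʳ (b ^ z)) ⟩
    b ^ z % M                     ∎
    where
    open ≡-Reasoning
    one : ∀ c → b ^ (c * D) ≈ 1
    one zero = refl
    one (suc c) = trans (cong (_% M) (^-distribˡ-+-* b D (c * D))) (*-≈ per (one c))

  -- This is L x = 2 F (x + 1) - F x, with `pred M` standing for -1.
  L-residue : ∀ x → 2 * F (suc x) + pred M * F x ≈ L x
  L-residue x = begin
    (2 * F (suc x) + pred M * F x) % M   ≡⟨ cong (λ y → (y + pred M * F x) % M) (sym (L+F x)) ⟩
    (L x + F x + pred M * F x) % M       ≡⟨ cong (_% M) (+-assoc (L x) (F x) _) ⟩
    (L x + suc (pred M) * F x) % M       ≡⟨ cong (λ m → (L x + m * F x) % M) (suc-pred M) ⟩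
    (L x + M * F x) % M                  ≡⟨ cong (λ y → (L x + y) % M) (*-comm M (F x)) ⟩
    (L x + F x * M) % M                  ≡⟨ [m+kn]%n≡m%n (L x) (F x) M ⟩
    L x % M                              ∎
    where open ≡-Reasoning

-- The sieve

-- A step refines the classes of m, y modulo N to classes modulo r N, and those of D modulo P to classes modulo s P, and
-- then discards classes: those violating the equation modulo M (congruent), those violating it modulo a divisor M of pᵉ,
-- with pᴰ ≡ 0 (vanishing), and those ruled out by descent-obstruction (descent).
data Kind : Set where
  congruent vanishing descent : Kind

record Step : Set where
  constructor step
  field
    kind  : Kind
    M r s : ℕ
    {{M≢0}} : NonZero M
    {{r≢0}} : NonZero r
    {{s≢0}} : NonZero s

all : {A : Set} → (A → Bool) → List A → Bool
all P [] = true
all P (a ∷ as) = P a ∧ all P as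

lifts : {A : Set} → (ℕ → A) → (r N x : ℕ) → List A
lifts g zero N x = []
lifts g (suc r) N x = g x ∷ lifts g r N (x + N)

all-lifts : ∀ {A : Set} (P : A → Bool) g r N x → all P (lifts g r N x) ≡ true → ∀ {i} → i < r → P (g (x + i * N)) ≡ true
all-lifts P g (suc r) N x eq {zero} _ = trans (cong (λ y → P (g y)) (+-identityʳ x)) (proj₁ (∧-true eq))
all-lifts P g (suc r) N x eq {suc i} (s≤s i<r) =
  trans (cong (λ y → P (g y)) (sym (+-assoc x N (i * N)))) (all-lifts P g r N (x + N) (proj₂ (∧-true eq)) i<r)

all-∈ : ∀ {A : Set} (P : A → Bool) as → all P as ≡ true → ∀ {a} → a ∈ as → P a ≡ true
all-∈ P (a ∷ as) eq (here refl) = proj₁ (∧-true eq)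
all-∈ P (a ∷ as) eq (there a∈) = all-∈ P as (proj₂ (∧-true eq)) a∈

all-range : ∀ (P : ℕ → Bool) n → all P (lifts id n 1 0) ≡ true → ∀ {i} → i < n → P i ≡ true
all-range P n eq {i} i<n = subst (λ j → P j ≡ true) (*-identityʳ i) (all-lifts P id n 1 0 eq i<n)

-- 2⁴⁰ exceeds every period that occurs.
halvings : ℕ
halvings = 40

pairsEqual : ℕ × ℕ → ℕ × ℕ → Bool
pairsEqual (a , b) (c , d) = (a ≡ᵇ c) ∧ (b ≡ᵇ d)

pairsEqual-sound : ∀ {p q} → pairsEqual p q ≡ true → p ≡ q
pairsEqual-sound eq = cong₂ _,_ (≡ᵇ-sound (proj₁ (∧-true eq))) (≡ᵇ-sound (proj₂ (∧-true eq)))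

-- The variables are m, y = k - 3 and the exponent z of b, so that n = m + (y + (u + 1)) and no index is negative.
module Sieve (b e u : ℕ) where

  xData : Step → ℕ → ℕ × ℕ × ℕ
  xData st x = x , Congruence.fib (Step.M st) halvings x

  yData : Step → ℕ → ℕ × (ℕ × ℕ) × ℕ
  yData st y = y , fib halvings (y + u) , proj₁ (fib halvings (y + 3))
    where open Congruence (Step.M st)

  powerResidue : Step → ℕ → ℕ
  powerResidue (step vanishing M _ _) z = 0
  powerResidue (step _ M _ _) z = Congruence.power M halvings b z

  zData : Step → ℕ → ℕ × ℕ
  zData st z = z , powerResidue st z

  -- The pairs are Fibonacci residues at x and at y + u. Since `2 * a′ + pred M * a` is L x and
  -- `a′ + 2 * a` is L (x + 1), the left-hand side is L n by the addition formula.
  arithmeticTest : (M : ℕ) {{_ : NonZero M}} → ℕ × ℕ → ℕ × ℕ → ℕ → ℕ → Bool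
  arithmeticTest M (a , a′) (g , g′) f w =
    (g′ * (a′ + 2 * a) + g * (2 * a′ + pred M * a)) % M ≡ᵇ ((2 * a′ + pred M * a) * w + f) % M

  -- Rejects exactly the configuration of `descent-obstruction` with `M` = 2^(3 + a); u = 2 means n
  -- = m + k.
  descentTest : (M : ℕ) {{_ : NonZero M}} → ℕ → ℕ → ℕ → Bool
  descentTest M x y z =
    not ((u ≡ᵇ 2) ∧ ((4 * x) % M ≡ᵇ 0) ∧ not ((2 * x) % M ≡ᵇ 0) ∧ ((y + 3) % M ≡ᵇ 0) ∧ (z % 2 ≡ᵇ 0))

  test : Step → ℕ × ℕ × ℕ → ℕ × (ℕ × ℕ) × ℕ → ℕ × ℕ → Bool
  test (step descent M _ _) (x , _) (y , _) (z , _) = descentTest M x y z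
  test (step _ M _ _) (_ , as) (_ , gs , f) (_ , w) = arithmeticTest M as gs f w

  sieve : List Step → (N D x y z : ℕ) → Bool
  explore : Step → List Step → (N D : ℕ) → List (ℕ × ℕ × ℕ) → List (ℕ × (ℕ × ℕ) × ℕ) → List (ℕ × ℕ) → Bool
  -- A class that outlives all steps makes the sieve fail, so `true` certifies that every class is
  -- discarded.
  sieve [] N D x y z = false
  sieve (st ∷ ss) N D x y z =
    explore st ss (r * N) (s * D) (lifts (xData st) r N x) (lifts (yData st) r N y) (lifts (zData st) s D z)
    where open Step st
  explore st ss N D xs ys zs =
    all (λ X → all (λ Y → all (λ Z → not (test st X Y Z) ∨ sieve ss N D (proj₁ X) (proj₁ Y) (proj₁ Z)) zs) ys) xs

  -- Ensures that the test depends only on the classes modulo `N` and `D`. For `vanishing` it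
  -- suffices that `b ^ e` is 0 modulo `M`, `e` being a lower bound for the exponent; the descent
  -- moduli 8 and 16 are the cases a = 0 and a = 1.
  compatible : Step → (N D : ℕ) → Bool
  compatible (step congruent M _ _) N D = pairsEqual (fib halvings N) (reduced 0) ∧ (power halvings b D ≡ᵇ 1 % M)
    where open Congruence M
  compatible (step vanishing M _ _) N D = pairsEqual (fib halvings N) (reduced 0) ∧ (power halvings b e ≡ᵇ 0 % M)
    where open Congruence M
  compatible (step descent M _ _) N D = ((M ≡ᵇ 8) ∨ (M ≡ᵇ 16)) ∧ (N % M ≡ᵇ 0) ∧ (D % 2 ≡ᵇ 0)

  wellFormed : List Step → (N D : ℕ) → Bool
  wellFormed [] N D = true
  wellFormed (st ∷ ss) N D = compatible st (r * N) (s * D) ∧ wellFormed ss (r * N) (s * D)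
    where open Step st

  module Soundness (X Y Z : ℕ) (e≤Z : e ≤ Z) (equation : L (X + suc (Y + u)) ≡ L X * b ^ Z + F (Y + 3))
    (no-descent : ∀ a → u ≡ 2 → 2 ^ (3 + a) ∣ 4 * X → ¬ 2 ^ (3 + a) ∣ 2 * X → 2 ^ (3 + a) ∣ Y + 3 → ¬ 2 ∣ Z) where

    open ≡-Reasoning

    arithmeticTest-true : ∀ M {{_ : NonZero M}} → (let open Congruence M) → ∀ {N} → IsPeriod N → ∀ cx x cy y w →
      x + cx * N ≡ X → y + cy * N ≡ Y → w ≈ b ^ Z →
      arithmeticTest M (fib halvings x) (fib halvings (y + u)) (proj₁ (fib halvings (y + 3))) w ≡ true
    arithmeticTest-true M {N} per cx x cy y w refl refl w≈
      rewrite Congruence.fib-correct M halvings x | Congruence.fib-correct M halvings (y + u) | Congruence.fib-correct M halvings (y + 3) =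
      ≡ᵇ-complete (begin
        (F (suc (y + u)) % M * l′ + F (y + u) % M * l) % M
          ≡⟨ +-≈ (*-≈ (at-Y (suc u) (sym (+-suc y u)) (sym (+-suc Y u))) l′≈) (*-≈ (at-Y u refl refl) l≈) ⟩
        (F (suc (Y + u)) * L (suc X) + F (Y + u) * L X) % M
          ≡⟨ cong (_% M) (sym (addition L L-like X (Y + u))) ⟩
        L (X + suc (Y + u)) % M
          ≡⟨ cong (_% M) equation ⟩
        (L X * b ^ Z + F (Y + 3)) % M
          ≡⟨ +-≈ (*-≈ l≈ w≈) (at-Y 3 refl refl) ⟨
        (l * w + F (y + 3) % M) % M ∎)
      where
      open Congruence M
      a = F x % M
      a′ = F (suc x) % M
      l = 2 * a′ + pred M * a
      l′ = a′ + 2 * a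
      a≈ : a ≈ F X
      a≈ = trans (%-≈ (F x)) (sym (F-periodic per cx x))
      a′≈ : a′ ≈ F (suc X)
      a′≈ = trans (%-≈ (F (suc x))) (sym (F-periodic per cx (suc x)))
      l≈ : l ≈ L X
      l≈ = trans (+-≈ (*-≈ {2} refl a′≈) (*-≈ {pred M} refl a≈)) (L-residue X)
      l′≈ : l′ ≈ L (suc X)
      l′≈ = trans (+-≈ a′≈ (*-≈ {2} refl a≈)) (cong (_% M) (sym (L-suc X)))
      at-Y : ∀ j {y′ Y′} → y′ ≡ y + j → Y′ ≡ Y + j → F y′ % M ≈ F Y′
      at-Y j refl refl = trans (%-≈ (F (y + j))) (sym (trans (cong (λ i → F i % M) (rearrange y (cy * N) j)) (F-periodic per cy (y + j))))
        where
        rearrange : ∀ y n j → (y + n) + j ≡ (y + j) + n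
        rearrange = solve-∀

    ∣-shift : ∀ {M} {{_ : NonZero M}} j i c N {x′} → N % M ≡ 0 → x′ ≡ i + j * c * N → x′ % M ≡ i % M
    ∣-shift {M} j i c N N%M≡0 refl = %-remove-+ʳ i (∣-trans (m%n≡0⇒n∣m N M N%M≡0) (subst (N ∣_) (*-comm N (j * c)) (m∣m*n (j * c))))

    descentTest-true : ∀ M {{_ : NonZero M}} a → M ≡ 2 ^ (3 + a) → ∀ {N D} → N % M ≡ 0 → D % 2 ≡ 0 → ∀ cx x cy y cz z →
      x + cx * N ≡ X → y + cy * N ≡ Y → z + cz * D ≡ Z → descentTest M x y z ≡ true
    descentTest-true M a M≡ {N} {D} N≡0 D≡0 cx x cy y cz z refl refl refl
      with u ≡ᵇ 2 in u≡2 | (4 * x) % M ≡ᵇ 0 in 4x | (2 * x) % M ≡ᵇ 0 in 2x | (y + 3) % M ≡ᵇ 0 in y3 | z % 2 ≡ᵇ 0 in z2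
    ... | false | _ | _ | _ | _ = refl
    ... | true | false | _ | _ | _ = refl
    ... | true | true | true | _ | _ = refl
    ... | true | true | false | false | _ = refl
    ... | true | true | false | true | false = refl
    ... | true | true | false | true | true =
      ⊥-elim (no-descent a (≡ᵇ-sound u≡2)
        (subst (_∣ 4 * X) M≡ (m%n≡0⇒n∣m _ M (trans (∣-shift 4 (4 * x) cx N N≡0 (distrib 4 x cx N)) (≡ᵇ-sound 4x))))
        (λ M∣2X → true≢false (trans (sym (≡ᵇ-complete (trans (sym (∣-shift 2 (2 * x) cx N N≡0 (distrib 2 x cx N))) (n∣m⇒m%n≡0 _ M (subst (_∣ 2 * X) (sym M≡) M∣2X))))) 2x))
        (subst (_∣ Y + 3) M≡ (m%n≡0⇒n∣m _ M (trans (∣-shift 1 (y + 3) cy N N≡0 (rearrange y cy N)) (≡ᵇ-sound y3))))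
        (m%n≡0⇒n∣m _ 2 (trans (∣-shift 1 z cz D D≡0 (cong (z +_) (cong (_* D) (sym (*-identityˡ cz))))) (≡ᵇ-sound z2))))
      where
      true≢false : ¬ (true ≡ false)
      true≢false ()
      distrib : ∀ k x c N → k * (x + c * N) ≡ k * x + k * c * N
      distrib = solve-∀
      rearrange : ∀ y c N → (y + c * N) + 3 ≡ (y + 3) + 1 * c * N
      rearrange = solve-∀

    test-true : ∀ st N D → compatible st N D ≡ true → ∀ cx x cy y cz z →
      x + cx * N ≡ X → y + cy * N ≡ Y → z + cz * D ≡ Z → test st (xData st x) (yData st y) (zData st z) ≡ true
    test-true (step congruent M _ _) N D ok cx x cy y cz z X≡ Y≡ Z≡ =
      arithmeticTest-true M per cx x cy y _ X≡ Y≡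
        (trans (cong (_% M) (power-correct halvings b z)) (trans (%-≈ (b ^ z)) (trans (sym (^-periodic unit cz z)) (cong (λ i → b ^ i % M) Z≡))))
      where
      open Congruence M
      per = trans (sym (fib-correct halvings N)) (pairsEqual-sound (proj₁ (∧-true ok)))
      unit = trans (sym (power-correct halvings b D)) (≡ᵇ-sound (proj₂ (∧-true ok)))
    test-true (step vanishing M _ _) N D ok cx x cy y cz z X≡ Y≡ Z≡ =
      arithmeticTest-true M per cx x cy y 0 X≡ Y≡
        (sym (trans (cong (λ i → b ^ i % M) (sym (m+[n∸m]≡n e≤Z)))
          (trans (cong (_% M) (^-distribˡ-+-* b e (Z ∸ e))) (trans (*-≈ {a′ = 0} null refl) refl))))
      where
      open Congruence M
      per = trans (sym (fib-correct halvings N)) (pairsEqual-sound (proj₁ (∧-true ok)))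
      null = trans (sym (power-correct halvings b e)) (≡ᵇ-sound (proj₂ (∧-true ok)))
    test-true (step descent M _ _) N D ok cx x cy y cz z X≡ Y≡ Z≡ with M ≡ᵇ 8 in M≡8 | M ≡ᵇ 16 in M≡16
    ... | true | _ = descentTest-true M 0 (≡ᵇ-sound M≡8) (≡ᵇ-sound (proj₁ (∧-true ok))) (≡ᵇ-sound (proj₂ (∧-true ok))) cx x cy y cz z X≡ Y≡ Z≡
    ... | false | true = descentTest-true M 1 (≡ᵇ-sound M≡16) (≡ᵇ-sound (proj₁ (∧-true ok))) (≡ᵇ-sound (proj₂ (∧-true ok))) cx x cy y cz z X≡ Y≡ Z≡
    test-true (step descent M _ _) N D () cx x cy y cz z X≡ Y≡ Z≡ | false | false

    refine : ∀ c r {{_ : NonZero r}} N x → (x + c % r * N) + c / r * (r * N) ≡ x + c * N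
    refine c r N x = begin
      (x + c % r * N) + c / r * (r * N)  ≡⟨ collect (c % r) (c / r) r N x ⟩
      x + (c % r + c / r * r) * N        ≡⟨ cong (λ i → x + i * N) (sym (m≡m%n+[m/n]*n c r)) ⟩
      x + c * N                          ∎
      where
      collect : ∀ i q r N x → (x + i * N) + q * (r * N) ≡ x + (i + q * r) * N
      collect = solve-∀

    sieve-sound : ∀ ss N D cx x cy y cz z → wellFormed ss N D ≡ true → sieve ss N D x y z ≡ true →
      x + cx * N ≡ X → y + cy * N ≡ Y → z + cz * D ≡ Z → ⊥
    sieve-sound (st ∷ ss) N D cx x cy y cz z wf sv X≡ Y≡ Z≡ =
      sieve-sound ss (r * N) (s * D) (cx / r) x′ (cy / r) y′ (cz / s) z′ (proj₂ (∧-true wf))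
        (trans (sym (cong (λ t → not t ∨ sieve ss (r * N) (s * D) x′ y′ z′) passes)) survives) X≡′ Y≡′ Z≡′
      where
      open Step st
      x′ = x + cx % r * N
      y′ = y + cy % r * N
      z′ = z + cz % s * D
      X≡′ = trans (refine cx r N x) X≡
      Y≡′ = trans (refine cy r N y) Y≡
      Z≡′ = trans (refine cz s D z) Z≡
      passes = test-true st (r * N) (s * D) (proj₁ (∧-true wf)) (cx / r) x′ (cy / r) y′ (cz / s) z′ X≡′ Y≡′ Z≡′
      survives = all-lifts _ (zData st) s D z (all-lifts _ (yData st) r N y (all-lifts _ (xData st) r N x sv (m%n<n cx r)) (m%n<n cy r)) (m%n<n cz s)

SievedBy : (p e : ℕ) → List Step → Set
SievedBy p e ss = all (λ u → Sieve.wellFormed p (suc e) u ss 1 1 ∧ Sieve.sieve p (suc e) u ss 1 1 0 0 0) (lifts id 8 1 0) ≡ true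

sieve-excludes : ∀ p e ss → SievedBy p e ss → .{{_ : NonZero p}} → ∀ m y u D → u < 8 → p ^ e < p ^ D →
  ¬ L (m + suc (y + u)) ≡ L m * p ^ D + F (y + 3)
sieve-excludes p e ss sieved m y u D u<8 pᵉ<pᴰ equation =
  -- Modulo 1 there is a single class, so the variables are their own quotients.
  sieve-sound ss 1 1 m 0 y 0 D 0 (proj₁ (∧-true ok)) (proj₂ (∧-true ok)) (*-identityʳ m) (*-identityʳ y) (*-identityʳ D)
  where
  ok = all-range (λ u → Sieve.wellFormed p (suc e) u ss 1 1 ∧ Sieve.sieve p (suc e) u ss 1 1 0 0 0) 8 sieved u<8
  e<D : e < D
  e<D = ≰⇒> λ D≤e → <⇒≱ pᵉ<pᴰ (^-monoʳ-≤ p D≤e)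
  no-descent : ∀ a → u ≡ 2 → 2 ^ (3 + a) ∣ 4 * m → ¬ 2 ^ (3 + a) ∣ 2 * m → 2 ^ (3 + a) ∣ y + 3 → ¬ 2 ∣ D
  no-descent a refl = descent-obstruction a m (y + 3) p D (subst (0 <_) (+-comm 3 y) (s≤s z≤n)) (subst (λ n → L (m + n) ≡ L m * p ^ D + F (y + 3)) (sym (+-suc y 2)) equation)
  open Sieve.Soundness p (suc e) u m y D e<D equation no-descent

-- Sieving moduli for p = 2, 3, 5, 6, 7, 10

steps2 : List Step
steps2 =
  step vanishing 2 3 1 ∷ step vanishing 4 2 1 ∷ step vanishing 8 2 1 ∷
  step vanishing 16 2 1 ∷ step congruent 3 1 2 ∷ step vanishing 32 2 1 ∷
  step congruent 7 1 3 ∷ step congruent 23 1 11 ∷ step vanishing 64 2 1 ∷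
  step congruent 1103 1 29 ∷ step congruent 47 1 23 ∷
  []

steps3 : List Step
steps3 =
  step vanishing 3 8 1 ∷ step vanishing 9 3 1 ∷ step vanishing 27 3 1 ∷
  step congruent 17 1 16 ∷ step congruent 19 1 9 ∷ step congruent 7 2 1 ∷
  -- As 3 divides `L m` only for m ≡ 2 modulo 4, the obstruction is needed with a = 0.
  step congruent 769 4 1 ∷ step descent 8 1 1 ∷ step vanishing 81 3 1 ∷
  step congruent 109 1 3 ∷ step congruent 19441 3 1 ∷ step vanishing 243 1 1 ∷
  []

steps5 : List Step
steps5 =
  step congruent 11 10 5 ∷ step vanishing 5 2 1 ∷ step congruent 3 2 2 ∷
  step congruent 41 1 2 ∷ step vanishing 25 5 1 ∷ step congruent 401 1 5 ∷
  step congruent 101 1 1 ∷ step congruent 251 5 1 ∷ step vanishing 125 1 1 ∷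
  step congruent 151 1 3 ∷ step congruent 61 3 1 ∷ step congruent 3001 1 5 ∷
  step congruent 181 3 1 ∷ step congruent 2251 1 3 ∷ step congruent 11251 5 1 ∷
  step vanishing 625 1 1 ∷
  []

steps6 : List Step
steps6 =
  step vanishing 2 3 1 ∷ step vanishing 4 2 1 ∷ step vanishing 8 2 1 ∷
  step vanishing 9 2 1 ∷ step vanishing 32 2 1 ∷ step congruent 7 1 2 ∷
  step congruent 23 1 11 ∷ step congruent 5 5 1 ∷ step congruent 31 1 3 ∷
  step congruent 11 1 5 ∷ step congruent 241 1 2 ∷
  []

steps7 : List Step
steps7 =
  step congruent 3 8 1 ∷ step vanishing 7 2 1 ∷ step vanishing 49 7 1 ∷
  step congruent 29 1 7 ∷ step congruent 13 1 12 ∷ step congruent 281 1 5 ∷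
  -- As 7 divides `L m` only for m ≡ 4 modulo 8, here a = 1.
  step descent 16 1 1 ∷ step congruent 43 11 1 ∷ step congruent 881 1 4 ∷
  step congruent 89 1 11 ∷ step congruent 1409 4 1 ∷ step vanishing 343 7 1 ∷
  step congruent 97 1 2 ∷ step congruent 5881 1 7 ∷ step congruent 1471 5 1 ∷
  step vanishing 2401 7 1 ∷ step congruent 13721 1 7 ∷
  []

steps10 : List Step
steps10 =
  step congruent 11 10 2 ∷ step vanishing 5 2 1 ∷ step congruent 3 2 1 ∷
  step congruent 41 1 5 ∷ step vanishing 16 3 1 ∷ step congruent 31 1 3 ∷
  step congruent 61 1 2 ∷
  []

sieved2 : SievedBy 2 13 steps2
sieved2 = refl

sieved3 : SievedBy 3 8 steps3
sieved3 = refl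

sieved5 : SievedBy 5 5 steps5
sieved5 = refl

sieved6 : SievedBy 6 5 steps6
sieved6 = refl

sieved7 : SievedBy 7 4 steps7
sieved7 = refl

sieved10 : SievedBy 10 4 steps10
sieved10 = refl

-- Small indices

does-sound : ∀ {P : Set} (P? : Dec P) → does P? ≡ true → P
does-sound (yes p) _ = p

<ᵇ-sound : ∀ {m n} → (m <ᵇ n) ≡ true → m < n
<ᵇ-sound {m} {n} eq = <ᵇ⇒< m n (Equivalence.from T-≡ eq)

_≟ᵀ_ : DecidableEquality Tuple
_≟ᵀ_ = ≡-dec _≟_ (≡-dec _≟_ (≡-dec _≟_ (≡-dec _≟_ _≟_)))

numDigits? : ∀ b N d → Dec (NumDigits b N d)
numDigits? b N zero = no λ ()
numDigits? b zero (suc zero) = yes zero-digits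
numDigits? b zero (suc (suc d)) = no λ { (pos-digits () _ _) }
numDigits? b (suc N) (suc d) =
  map′ (λ (p , q) → pos-digits (s≤s z≤n) p q) (λ { (pos-digits _ p q) → p , q }) ((b ^ d ≤? suc N) ×-dec (suc N <? b ^ suc d))

isSolution : Tuple → Bool
isSolution t = does (_∈?_ _≟ᵀ_ t solutions)

advance : ℕ × ℕ → ℕ × ℕ
advance (a , a′) = a′ , a′ + a

lucas : ℕ → ℕ × ℕ
lucas zero = 2 , 1
lucas (suc n) = advance (lucas n)

lucas-correct : ∀ n → lucas n ≡ (L n , L (suc n))
lucas-correct zero = refl
lucas-correct (suc n) rewrite lucas-correct n = refl

module Walk (k b d B f : ℕ) where

  -- Strict inequality at two consecutive indices persists under the recurrence. The summand `f` is
  -- left out of `dominated`, since adding two inequalities would double it; in `dominating` the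
  -- doubling helps.
  dominated dominating : ℕ × ℕ → ℕ × ℕ → Bool
  dominated (a , a′) (c , c′) = (a <ᵇ c * B) ∧ (a′ <ᵇ c′ * B)
  dominating (a , a′) (c , c′) = (c * B + f <ᵇ a) ∧ (c′ * B + f <ᵇ a′)

  walk : ℕ → (n m : ℕ) → ℕ × ℕ → ℕ × ℕ → Bool
  walk zero n m as cs = false
  walk (suc t) n m as@(a , a′) cs@(c , c′) =
    (if a ≡ᵇ c * B + f then isSolution (n , m , k , b , d) else true) ∧
    (dominated as cs ∨ dominating as cs ∨ walk t (suc n) (suc m) (advance as) (advance cs))

  dominated-persists : ∀ n m → L n < L m * B → L (suc n) < L (suc m) * B → ∀ j → L (j + n) < L (j + m) * B
  dominated-persists n m p q zero = p
  dominated-persists n m p q (suc zero) = q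
  dominated-persists n m p q (suc (suc j)) =
    subst (L (2 + j + n) <_) (sym (*-distribʳ-+ B (L (1 + j + m)) (L (j + m))))
      (+-mono-< (dominated-persists n m p q (suc j)) (dominated-persists n m p q j))

  dominating-persists : ∀ n m → L m * B + f < L n → L (suc m) * B + f < L (suc n) → ∀ j → L (j + m) * B + f < L (j + n)
  dominating-persists n m p q zero = p
  dominating-persists n m p q (suc zero) = q
  dominating-persists n m p q (suc (suc j)) = begin-strict
    (L (1 + j + m) + L (j + m)) * B + f                 ≤⟨ m≤m+n _ f ⟩
    (L (1 + j + m) + L (j + m)) * B + f + f             ≡⟨ distrib (L (1 + j + m)) (L (j + m)) B f ⟩
    (L (1 + j + m) * B + f) + (L (j + m) * B + f)       <⟨ +-mono-< (dominating-persists n m p q (suc j)) (dominating-persists n m p q j) ⟩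
    L (1 + j + n) + L (j + n)                           ∎
    where
    open ≤-Reasoning
    distrib : ∀ x y B f → (x + y) * B + f + f ≡ (x * B + f) + (y * B + f)
    distrib = solve-∀

  walk-sound : ∀ t n m → walk t n m (L n , L (suc n)) (L m , L (suc m)) ≡ true →
    ∀ j → L (j + n) ≡ L (j + m) * B + f → (j + n , j + m , k , b , d) ∈ solutions
  walk-sound (suc t) n m ok zero equation =
    does-sound (_∈?_ _≟ᵀ_ (n , m , k , b , d) solutions) (trans (sym (cong (λ x → if x then isSolution (n , m , k , b , d) else true) (≡ᵇ-complete equation))) (proj₁ (∧-true ok)))
  walk-sound (suc t) n m ok (suc j) equation
    with dominated (L n , L (suc n)) (L m , L (suc m)) in less | dominating (L n , L (suc n)) (L m , L (suc m)) in greater | proj₂ (∧-true {if L n ≡ᵇ L m * B + f then isSolution (n , m , k , b , d) else true} ok)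
  ... | true | _ | _ = ⊥-elim (<-irrefl equation (≤-trans (dominated-persists n m (<ᵇ-sound (proj₁ (∧-true less))) (<ᵇ-sound (proj₂ (∧-true less))) (suc j)) (m≤m+n _ f)))
  ... | false | true | _ = ⊥-elim (<-irrefl (sym equation) (dominating-persists n m (<ᵇ-sound (proj₁ (∧-true greater))) (<ᵇ-sound (proj₂ (∧-true greater))) (suc j)))
  ... | false | false | rest =
    subst₂ (λ n′ m′ → (n′ , m′ , k , b , d) ∈ solutions) (+-suc j n) (+-suc j m)
      (walk-sound t (suc n) (suc m) rest j (subst₂ (λ n′ m′ → L n′ ≡ L m′ * B + f) (sym (+-suc j n)) (sym (+-suc j m)) equation))

-- With s = k + u, the pairs satisfying n + 2 = m + s start at (s - 2, 0), or at (0, 2 - s) when s <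
-- 2; the truncated subtractions cover both cases. Exhausting the 60 steps would make the check
-- fail.
smallGap : (b k d f u : ℕ) → Bool
smallGap b k d f u = Walk.walk k b d (b ^ d) f 60 (k + u ∸ 2) (2 ∸ (k + u)) (lucas (k + u ∸ 2)) (lucas (2 ∸ (k + u)))

smallDigits : (b k f d : ℕ) → Bool
smallDigits b k f d = not (does (numDigits? b f d)) ∨ all (smallGap b k d f) (lifts id 9 1 0)

smallIndex : (b k f : ℕ) → Bool
smallIndex b k f = all (smallDigits b k f) (lifts id 14 1 0)

-- The ranges are 2 ≤ b ≤ 10, k ≤ 20, d ≤ 13 and u ≤ 8; the one for d comes from `F 20` = 6765 <
-- 2^13.
small-checked : all (λ b → all (λ k → smallIndex (2 + b) k (F k)) (lifts id 21 1 0)) (lifts id 9 1 0) ≡ true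
small-checked = refl

-- The equation

-- The upper bound is split because 0 counts as one digit: then `b ^ d` is b, which is not at most
-- `10 * N`.
record DigitBounds (b N d : ℕ) : Set where
  field
    2≤bᵈ      : 2 ≤ b ^ d
    N<bᵈ      : N < b ^ d
    zero≤     : N ≡ 0 → b ^ d ≤ 10
    positive≤ : 1 ≤ N → b ^ d ≤ 10 * N
    short     : N < 2 ^ 13 → d < 14

digitBounds : ∀ {b N d} → 2 ≤ b → b ≤ 10 → NumDigits b N d → DigitBounds b N d
digitBounds {b} 2≤b b≤10 zero-digits = record
  { 2≤bᵈ = 2≤b¹ ; N<bᵈ = ≤-trans (s≤s z≤n) 2≤b¹ ; zero≤ = λ _ → subst (_≤ 10) (sym (*-identityʳ b)) b≤10
  ; positive≤ = λ () ; short = λ _ → m≤m+n 2 12 }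
  where
  2≤b¹ : 2 ≤ b ^ 1
  2≤b¹ = subst (2 ≤_) (sym (*-identityʳ b)) 2≤b
digitBounds {b} {N} {suc d} 2≤b b≤10 (pos-digits 1≤N bᵈ≤N N<b¹⁺ᵈ) = record
  { 2≤bᵈ = ≤-trans (s≤s 1≤N) N<b¹⁺ᵈ ; N<bᵈ = N<b¹⁺ᵈ ; zero≤ = λ { refl → ⊥-elim (<-irrefl refl 1≤N) }
  ; positive≤ = λ _ → *-mono-≤ b≤10 bᵈ≤N
  ; short = λ N<2¹³ → s≤s (≰⇒> λ 13≤d → <⇒≱ N<2¹³ (≤-trans (^-monoʳ-≤ 2 13≤d) (≤-trans (^-monoˡ-≤ d 2≤b) bᵈ≤N))) }

-- The value u = 8 does occur for k = 0, in the solution (6, 0, 0, 9, 1), so the sieve bound u < 8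
-- is only claimed for positive k.
gap : ∀ n m k B → 2 ≤ B → F k < B → (F k ≡ 0 → B ≤ 10) → (1 ≤ F k → B ≤ 10 * F k) → L n ≡ L m * B + F k →
  ∃ λ u → n + 2 ≡ m + (k + u) × u < 9 × (0 < k → u < 8)
gap n m zero B 2≤B F<B zero≤ _ equation = n + 2 ∸ m , sym (m+[n∸m]≡n m≤) , u<9 , λ ()
  where
  m≤ : m ≤ n + 2
  m≤ = ≤-trans (lower-zero n m B 2≤B equation) (≤-trans (≤-reflexive (+-comm 1 n)) (+-monoʳ-≤ n (s≤s z≤n)))
  u<9 : n + 2 ∸ m < 9
  u<9 = +-cancelˡ-< m _ 9 (subst₂ _<_ (sym (m+[n∸m]≡n m≤)) (+-assoc m 7 2) (+-monoˡ-< 2 (upper-zero n m B (zero≤ refl) equation)))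
gap n m (suc k) B 2≤B F<B _ positive≤ equation = u , trans (sym n+2) (+-assoc m (suc k) u) , m≤n⇒m≤1+n u<8 , λ _ → u<8
  where
  lower : ∀ k → F (suc k) < B → L n ≡ L m * B + F (suc k) → m + suc k ≤ n + 2
  lower 0 _ equation = +-mono-≤ (lower-positive n m 0 B 2≤B equation) (s≤s z≤n)
  lower 1 _ equation = +-mono-≤ (lower-positive n m 1 B 2≤B equation) ≤-refl
  lower (suc (suc y)) F<B equation = subst₂ _≤_ (rearrange m y) (+-comm 2 n) (s≤s (s≤s (lower-large n m y B F<B equation)))
    where
    rearrange : ∀ m y → 3 + (m + y) ≡ m + (3 + y)
    rearrange = solve-∀
  u = n + 2 ∸ (m + suc k)
  n+2 : m + suc k + u ≡ n + 2
  n+2 = m+[n∸m]≡n (lower k F<B equation)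
  u<8 : u < 8
  u<8 = +-cancelˡ-< (m + suc k) u 8 (subst₂ _<_ (sym n+2) (rearrange m k) (+-monoˡ-< 2 (upper-positive n m k B (positive≤ (0<F k)) equation)))
    where
    rearrange : ∀ m k → m + (7 + k) + 2 ≡ m + suc k + 8
    rearrange = solve-∀

align : ∀ s n m → n + 2 ≡ m + s → ∃ λ j → n ≡ j + (s ∸ 2) × m ≡ j + (2 ∸ s)
align 0 n m eq = n , sym (+-identityʳ n) , trans (sym (+-identityʳ m)) (sym eq)
align 1 n m eq = n , sym (+-identityʳ n) , +-cancelʳ-≡ 1 m (n + 1) (trans (sym eq) (sym (+-assoc n 1 1)))
align (suc (suc s)) n m eq = m , +-cancelʳ-≡ 2 n (m + s) (trans eq (rearrange m s)) , trans (sym (+-identityʳ m)) (cong (m +_) (sym (0∸n≡0 s)))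
  where
  rearrange : ∀ m s → m + (2 + s) ≡ m + s + 2
  rearrange = solve-∀

small : ∀ b n m k d u → b < 9 → k < 21 → d < 14 → u < 9 → NumDigits (2 + b) (F k) d → n + 2 ≡ m + (k + u) →
  L n ≡ L m * (2 + b) ^ d + F k → (n , m , k , 2 + b , d) ∈ solutions
small b n m k d u b<9 k<21 d<14 u<9 digits n+2 equation with align (k + u) n m n+2
... | j , refl , refl =
  Walk.walk-sound k (2 + b) d ((2 + b) ^ d) (F k) 60 (k + u ∸ 2) (2 ∸ (k + u))
    (subst₂ (λ as cs → Walk.walk k (2 + b) d ((2 + b) ^ d) (F k) 60 (k + u ∸ 2) (2 ∸ (k + u)) as cs ≡ true)
      (lucas-correct (k + u ∸ 2)) (lucas-correct (2 ∸ (k + u))) at-u)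
    j equation
  where
  at-b = all-range (λ b → all (λ k → smallIndex (2 + b) k (F k)) (lifts id 21 1 0)) 9 small-checked b<9
  at-k = all-range (λ k → smallIndex (2 + b) k (F k)) 21 at-b k<21
  at-d = all-range (smallDigits (2 + b) k (F k)) 14 at-k d<14
  at-u = all-range (smallGap (2 + b) k d (F k)) 9
    (trans (sym (cong (λ x → not x ∨ all (smallGap (2 + b) k d (F k)) (lifts id 9 1 0)) (dec-true (numDigits? (2 + b) (F k) d) digits))) at-d) u<9

large : ∀ b n m y d u → b < 9 → 18 ≤ y → u < 8 → F (3 + y) < (2 + b) ^ d → n + 2 ≡ m + (3 + y + u) →
  ¬ L n ≡ L m * (2 + b) ^ d + F (3 + y)
large b n m y d u b<9 18≤y u<8 F<bᵈ n+2 equation = cases b b<9 F<bᵈ shifted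
  where
  n≡ : n ≡ m + suc (y + u)
  n≡ = +-cancelʳ-≡ 2 n _ (trans n+2 (rearrange m y u))
    where
    rearrange : ∀ m y u → m + (3 + y + u) ≡ m + suc (y + u) + 2
    rearrange = solve-∀
  shifted : L (m + suc (y + u)) ≡ L m * (2 + b) ^ d + F (y + 3)
  shifted = subst₂ (λ i j → L i ≡ L m * (2 + b) ^ d + F j) n≡ (+-comm 3 y) equation
  -- Here 10946 is `F 21`, and each `e` below is the largest exponent with `p ^ e` ≤ 10946, so the
  -- exponent of p exceeds `e`. The parameter `c` treats the bases 4, 8 and 9 as powers of 2 and 3.
  excluded : ∀ p e c ss → SievedBy p e ss → .{{_ : NonZero p}} → p ^ e ≤ 10946 → F (3 + y) < (p ^ c) ^ d →
    ¬ L (m + suc (y + u)) ≡ L m * (p ^ c) ^ d + F (y + 3)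
  excluded p e c ss sieved pᵉ≤ F<
    rewrite ^-*-assoc p c d = sieve-excludes p e ss sieved m y u (c * d) u<8 (≤-<-trans pᵉ≤ (≤-<-trans (F-mono {21} {3 + y} (+-monoʳ-≤ 3 18≤y)) F<))
  cases : ∀ b → b < 9 → F (3 + y) < (2 + b) ^ d → ¬ L (m + suc (y + u)) ≡ L m * (2 + b) ^ d + F (y + 3)
  cases 0 _ = excluded 2 13 1 steps2 sieved2 (≤ᵇ⇒≤ _ _ _)
  cases 1 _ = excluded 3 8 1 steps3 sieved3 (≤ᵇ⇒≤ _ _ _)
  cases 2 _ = excluded 2 13 2 steps2 sieved2 (≤ᵇ⇒≤ _ _ _)
  cases 3 _ = excluded 5 5 1 steps5 sieved5 (≤ᵇ⇒≤ _ _ _)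
  cases 4 _ = excluded 6 5 1 steps6 sieved6 (≤ᵇ⇒≤ _ _ _)
  cases 5 _ = excluded 7 4 1 steps7 sieved7 (≤ᵇ⇒≤ _ _ _)
  cases 6 _ = excluded 2 13 3 steps2 sieved2 (≤ᵇ⇒≤ _ _ _)
  cases 7 _ = excluded 3 8 2 steps3 sieved3 (≤ᵇ⇒≤ _ _ _)
  cases 8 _ = excluded 10 4 1 steps10 sieved10 (≤ᵇ⇒≤ _ _ _)
  cases (suc (suc (suc (suc (suc (suc (suc (suc (suc _))))))))) b<9 with () ← <⇒≱ b<9 (m≤m+n 9 _)

IsSolution : Tuple → Set
IsSolution (n , m , k , b , d) = NumDigits b (F k) d × L n ≡ L m * b ^ d + F k

isSolution? : ∀ t → Dec (IsSolution t)
isSolution? (n , m , k , b , d) = numDigits? b (F k) d ×-dec (L n ≟ L m * b ^ d + F k)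

solutions-sound : ∀ {t} → t ∈ solutions → IsSolution t
solutions-sound {t} t∈ = does-sound (isSolution? t) (all-∈ (λ t → does (isSolution? t)) solutions refl t∈)

solutions-complete : ∀ n m k b d → b < 9 → IsSolution (n , m , k , 2 + b , d) → (n , m , k , 2 + b , d) ∈ solutions
solutions-complete n m k b d b<9 (digits , equation) with gap n m k ((2 + b) ^ d) 2≤bᵈ N<bᵈ zero≤ positive≤ equation
  where
  open DigitBounds (digitBounds (s≤s (s≤s z≤n)) (s≤s b<9) digits)
... | u , n+2 , u<9 , u<8 with k <? 21
... | yes k<21 = small b n m k d u b<9 k<21 (DigitBounds.short bounds F<2¹³) u<9 digits n+2 equation
  where
  bounds = digitBounds (s≤s (s≤s z≤n)) (s≤s b<9) digits
  F<2¹³ : F k < 2 ^ 13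
  F<2¹³ = ≤-<-trans (F-mono {k} {20} (≤-pred k<21)) (<ᵇ⇒< _ _ _)
... | no k≮21 = ⊥-elim (excluded k (≮⇒≥ k≮21) (DigitBounds.N<bᵈ bounds) n+2 u<8 equation)
  where
  bounds = digitBounds (s≤s (s≤s z≤n)) (s≤s b<9) digits
  excluded : ∀ k → 21 ≤ k → F k < (2 + b) ^ d → n + 2 ≡ m + (k + u) → (0 < k → u < 8) → ¬ L n ≡ L m * (2 + b) ^ d + F k
  excluded (suc (suc (suc y))) (s≤s (s≤s (s≤s 18≤y))) F<bᵈ n+2 u<8 = large b n m y d u b<9 18≤y (u<8 (s≤s z≤n)) F<bᵈ n+2

theorem1p1 : (n m k b d : ℕ) → 2 ≤ b → b ≤ 10 →
    ((NumDigits b (F k) d × L n ≡ L m * b ^ d + F k) ⇔ ((n , m , k , b , d) ∈ solutions))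
theorem1p1 n m k (suc (suc b)) d _ (s≤s b<9) = mk⇔ (solutions-complete n m k b d b<9) solutions-sound
theorem1p1 n m k (suc zero) d (s≤s ()) _
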